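{- Let $l \geq 1$ be an integer and let $S$ be a string of $l$ decimal digits. Then there exists a prime number $p$ whose decimal representation contains $S$ and which satisfies $$\frac{\log p}{\log \log p} \leq 5.7\, l^2 \times 10^l .$$
   Context: A string of $l$ decimal digits is a finite sequence of $l$ elements of $\{0,1,\dots,9\}$ (leading zeros are allowed). The decimal representation of a positive integer is its usual base-10 expansion without leading zeros; it contains $S$ if $S$ occurs in it as a block of consecutive digits. $\log$ denotes the natural logarithm. -}

module Defs where

open import Data.Digit using (Decimal; Expansion; fromDigits)
open import Data.Fin.Base as Fin using ()
open import Data.Integer.Base as ℤ using (+_; -[1+_])
import Data.Integer.Properties as ℤₚ
open import Data.List.Base using (List; []; _∷_; reverse)
open import Data.List.Relation.Binary.Infix.Heterogeneous using (Infix)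
open import Data.Nat.Base as ℕ using (ℕ; zero; suc)
import Data.Nat.Properties as ℕₚ
open import Data.Product.Base using (Σ; ∃; ∃-syntax; Σ-syntax; _×_; _,_; proj₁; proj₂)
open import Data.Rational.Base
open import Data.Rational.Properties
open import Data.Rational.Solver using (module +-*-Solver)
import Data.Rational.Unnormalised.Base as ℚᵘ
import Data.Rational.Unnormalised.Properties as ℚᵘₚ
open import Data.Sum.Base as Sum using (_⊎_; inj₁; inj₂; swap)
open import Data.Vec.Base using (Vec; toList)
open import Relation.Binary.PropositionalEquality
  using (_≡_; _≢_; refl; sym; trans; cong; cong₂; subst; subst₂; module ≡-Reasoning)
open import Relation.Binary.Definitions using (tri<; tri≈; tri>)
open import Relation.Nullary.Negation using (¬_; contradiction)

open import Algebra.Definitions.RawSemiring +-*-rawSemiring using (_^_)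
open import Algebra.Bundles using (CommutativeRing)
open import Algebra.Properties.CommutativeSemiring.Exp
  (CommutativeRing.commutativeSemiring +-*-commutativeRing)
  using (^-distrib-*; ^-assocʳ)

open +-*-Solver using (solve; con; _:+_; _:*_; _:-_; _:=_) renaming (:-_ to :neg_)

-- Most significant digit first, whereas fromDigits reads the least
-- significant digit first.
data IsDecimalRepresentation (n : ℕ) : Expansion 10 → Set where
  decimal : ∀ {d ds} → d ≢ Fin.zero → fromDigits (reverse (d ∷ ds)) ≡ n →
            IsDecimalRepresentation n (d ∷ ds)

_Contains_ : ∀ {l} → ℕ → Vec Decimal l → Set
n Contains S =
  ∃[ ds ] IsDecimalRepresentation n ds × Infix _≡_ (toList S) ds

*-monoˡ : ∀ {p q r} → 0ℚ ≤ r → p ≤ q → r * p ≤ r * q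
*-monoˡ {r = r} 0≤r = *-monoˡ-≤-nonNeg r {{nonNegative 0≤r}}

*-monoʳ : ∀ {p q r} → 0ℚ ≤ r → p ≤ q → p * r ≤ q * r
*-monoʳ {r = r} 0≤r = *-monoʳ-≤-nonNeg r {{nonNegative 0≤r}}

*-strictˡ : ∀ {p q r} → 0ℚ < r → p < q → r * p < r * q
*-strictˡ {r = r} 0<r = *-monoʳ-<-pos r {{positive 0<r}}

*-strictʳ : ∀ {p q r} → 0ℚ < r → p < q → p * r < q * r
*-strictʳ {r = r} 0<r = *-monoˡ-<-pos r {{positive 0<r}}

*-cancelʳ : ∀ {p q r} → 0ℚ < r → p * r < q * r → p < q
*-cancelʳ {r = r} 0<r = *-cancelʳ-<-nonNeg r {{nonNegative (<⇒≤ 0<r)}}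

*-mono : ∀ {p q r s} → 0ℚ ≤ p → 0ℚ ≤ r → p ≤ q → r ≤ s → p * r ≤ q * s
*-mono 0≤p 0≤r p≤q r≤s =
  ≤-trans (*-monoʳ 0≤r p≤q) (*-monoˡ (≤-trans 0≤p p≤q) r≤s)

0<* : ∀ {p q} → 0ℚ < p → 0ℚ < q → 0ℚ < p * q
0<* {p} {q} 0<p 0<q = subst (_< p * q) (*-zeroʳ p) (*-strictˡ 0<p 0<q)

0≤* : ∀ {p q} → 0ℚ ≤ p → 0ℚ ≤ q → 0ℚ ≤ p * q
0≤* {p} {q} 0≤p 0≤q = subst (_≤ p * q) (*-zeroʳ p) (*-monoˡ 0≤p 0≤q)

p≤∣p∣ : ∀ p → p ≤ ∣ p ∣
p≤∣p∣ p with ≤-total 0ℚ p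
... | inj₁ 0≤p = ≤-reflexive (sym (0≤p⇒∣p∣≡p 0≤p))
... | inj₂ p≤0 = ≤-trans p≤0 (0≤∣p∣ p)

-p≤∣p∣ : ∀ p → - p ≤ ∣ p ∣
-p≤∣p∣ p = subst (- p ≤_) (∣-p∣≡∣p∣ p) (p≤∣p∣ (- p))

0≤p*p : ∀ p → 0ℚ ≤ p * p
0≤p*p p with ≤-total 0ℚ p
... | inj₁ 0≤p = 0≤* 0≤p 0≤p
... | inj₂ p≤0 = subst (0ℚ ≤_) (solve 1 (λ x → (:neg x) :* (:neg x) := x :* x) refl p)
                   (0≤* (neg-antimono-≤ p≤0) (neg-antimono-≤ p≤0))

p<q⇒0<q-p : ∀ {p q} → p < q → 0ℚ < q - p
p<q⇒0<q-p {p} {q} p<q = subst (_< q - p) (+-inverseʳ p) (+-monoˡ-< (- p) p<q)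

0<q-p⇒p<q : ∀ {p q} → 0ℚ < q - p → p < q
0<q-p⇒p<q {p} {q} 0<q-p = subst₂ _<_ (+-identityˡ p)
  (solve 2 (λ x y → (y :- x) :+ x := y) refl p q) (+-monoˡ-< p 0<q-p)

p<p+q : ∀ {p q} → 0ℚ < q → p < p + q
p<p+q {p} {q} 0<q = subst (_< p + q) (+-identityʳ p) (+-monoʳ-< p 0<q)

p-q<p : ∀ {p q} → 0ℚ < q → p - q < p
p-q<p {p} {q} 0<q = subst (p - q <_) (+-identityʳ p) (+-monoʳ-< p (neg-antimono-< 0<q))

0<1ℚ : 0ℚ < 1ℚ
0<1ℚ = positive⁻¹ 1ℚ

recip : ∀ p → 0ℚ < p → ℚ
recip p 0<p = (1/ p) {{>-nonZero 0<p}}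

*-recip : ∀ p (0<p : 0ℚ < p) → p * recip p 0<p ≡ 1ℚ
*-recip p 0<p = *-inverseʳ p {{>-nonZero 0<p}}

0<recip : ∀ p (0<p : 0ℚ < p) → 0ℚ < recip p 0<p
0<recip p 0<p = positive⁻¹ _ {{1/pos⇒pos p {{positive 0<p}}}}

⊔-lub-< : ∀ p q {r} → p < r → q < r → p ⊔ q < r
⊔-lub-< p q p<r q<r with ⊔-sel p q
... | inj₁ eq = subst (_< _) (sym eq) p<r
... | inj₂ eq = subst (_< _) (sym eq) q<r

⊓-glb-< : ∀ p q {r} → r < p → r < q → r < p ⊓ q
⊓-glb-< p q r<p r<q with ⊓-sel p q
... | inj₁ eq = subst (_ <_) (sym eq) r<p
... | inj₂ eq = subst (_ <_) (sym eq) r<q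

ι : ℕ → ℚ
ι n = + n / 1

ι-+ : ∀ m n → ι (m ℕ.+ n) ≡ ι m + ι n
ι-+ m n = toℚᵘ-injective (begin
  toℚᵘ (ι (m ℕ.+ n))                        ≈⟨ toℚᵘ-fromℚᵘ (ℚᵘ.mkℚᵘ (+ (m ℕ.+ n)) 0) ⟩
  ℚᵘ.mkℚᵘ (+ (m ℕ.+ n)) 0                   ≈⟨ ℚᵘ.*≡* (cong (ℤ._* + 1) (sym (cong₂ ℤ._+_ (ℤₚ.*-identityʳ (+ m)) (ℤₚ.*-identityʳ (+ n))))) ⟩
  ℚᵘ.mkℚᵘ (+ m) 0 ℚᵘ.+ ℚᵘ.mkℚᵘ (+ n) 0      ≈⟨ ℚᵘₚ.+-cong (toℚᵘ-fromℚᵘ (ℚᵘ.mkℚᵘ (+ m) 0)) (toℚᵘ-fromℚᵘ (ℚᵘ.mkℚᵘ (+ n) 0)) ⟨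
  toℚᵘ (ι m) ℚᵘ.+ toℚᵘ (ι n)                ≈⟨ toℚᵘ-homo-+ (ι m) (ι n) ⟨
  toℚᵘ (ι m + ι n)                          ∎)
  where open ℚᵘₚ.≃-Reasoning

ι-* : ∀ m n → ι (m ℕ.* n) ≡ ι m * ι n
ι-* m n = toℚᵘ-injective (begin
  toℚᵘ (ι (m ℕ.* n))                        ≈⟨ toℚᵘ-fromℚᵘ (ℚᵘ.mkℚᵘ (+ (m ℕ.* n)) 0) ⟩
  ℚᵘ.mkℚᵘ (+ (m ℕ.* n)) 0                   ≈⟨ ℚᵘ.*≡* (cong (ℤ._* + 1) (ℤₚ.pos-* m n)) ⟩
  ℚᵘ.mkℚᵘ (+ m) 0 ℚᵘ.* ℚᵘ.mkℚᵘ (+ n) 0      ≈⟨ ℚᵘₚ.*-cong (toℚᵘ-fromℚᵘ (ℚᵘ.mkℚᵘ (+ m) 0)) (toℚᵘ-fromℚᵘ (ℚᵘ.mkℚᵘ (+ n) 0)) ⟨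
  toℚᵘ (ι m) ℚᵘ.* toℚᵘ (ι n)                ≈⟨ toℚᵘ-homo-* (ι m) (ι n) ⟨
  toℚᵘ (ι m * ι n)                          ∎)
  where open ℚᵘₚ.≃-Reasoning

ι-*-1/ : ∀ n → ι (suc n) * (+ 1 / suc n) ≡ 1ℚ
ι-*-1/ n = toℚᵘ-injective (begin
  toℚᵘ (ι (suc n) * (+ 1 / suc n))          ≈⟨ toℚᵘ-homo-* (ι (suc n)) (+ 1 / suc n) ⟩
  toℚᵘ (ι (suc n)) ℚᵘ.* toℚᵘ (+ 1 / suc n)  ≈⟨ ℚᵘₚ.*-cong (toℚᵘ-fromℚᵘ (ℚᵘ.mkℚᵘ (+ suc n) 0)) (toℚᵘ-fromℚᵘ (ℚᵘ.mkℚᵘ (+ 1) n)) ⟩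
  ℚᵘ.mkℚᵘ (+ suc n) 0 ℚᵘ.* ℚᵘ.mkℚᵘ (+ 1) n  ≈⟨ ℚᵘ.*≡* (trans (ℤₚ.*-identityʳ _) (cong +_ (trans (ℕₚ.*-identityʳ (suc n)) (sym (trans (ℕₚ.*-identityˡ _) (ℕₚ.*-identityˡ (suc n))))))) ⟩
  toℚᵘ 1ℚ                                   ∎)
  where open ℚᵘₚ.≃-Reasoning

0<ι : ∀ n → 0ℚ < ι (suc n)
0<ι n = positive⁻¹ (ι (suc n)) {{normalize-pos (suc n) 1}}

0≤ι : ∀ n → 0ℚ ≤ ι n
0≤ι n = nonNegative⁻¹ (ι n) {{normalize-nonNeg n 1}}

0<1/ : ∀ n → 0ℚ < + 1 / suc n
0<1/ n = positive⁻¹ (+ 1 / suc n) {{normalize-pos 1 (suc n)}}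

i<1+∣i∣ : ∀ i d → i ℤ.* + 1 ℤ.< + suc ℤ.∣ i ∣ ℤ.* + suc d
i<1+∣i∣ (+ a) d = subst₂ ℤ._<_ (sym (ℤₚ.*-identityʳ (+ a))) (ℤₚ.pos-* (suc a) (suc d))
  (ℤ.+<+ (ℕₚ.<-≤-trans (ℕₚ.n<1+n a) (ℕₚ.m≤m*n (suc a) (suc d))))
i<1+∣i∣ -[1+ a ] d = ℤ.-<+

archimedean : ∀ q → ∃[ n ] q < ι (suc n)
archimedean q@(mkℚ i d _) = ℤ.∣ i ∣ , toℚᵘ-cancel-<
  (ℚᵘₚ.<-respʳ-≃ (ℚᵘₚ.≃-sym (toℚᵘ-fromℚᵘ (ℚᵘ.mkℚᵘ (+ suc ℤ.∣ i ∣) 0)))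
    (ℚᵘ.*<* (i<1+∣i∣ i d)))

0<^ : ∀ {p} n → 0ℚ < p → 0ℚ < p ^ n
0<^ zero    0<p = 0<1ℚ
0<^ (suc n) 0<p = 0<* 0<p (0<^ n 0<p)

0≤^ : ∀ {p} n → 0ℚ ≤ p → 0ℚ ≤ p ^ n
0≤^ zero    0≤p = <⇒≤ 0<1ℚ
0≤^ (suc n) 0≤p = 0≤* 0≤p (0≤^ n 0≤p)

^-mono : ∀ {p q} n → 0ℚ ≤ p → p ≤ q → p ^ n ≤ q ^ n
^-mono zero    0≤p p≤q = ≤-refl
^-mono (suc n) 0≤p p≤q = *-mono 0≤p (0≤^ n 0≤p) p≤q (^-mono n 0≤p p≤q)

^-≤1 : ∀ {p} n → 0ℚ ≤ p → p ≤ 1ℚ → p ^ n ≤ 1ℚ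
^-≤1 zero    0≤p p≤1 = ≤-refl
^-≤1 (suc n) 0≤p p≤1 = *-mono 0≤p (0≤^ n 0≤p) p≤1 (^-≤1 n 0≤p p≤1)

1<^ : ∀ {p} n → 1ℚ < p → 1ℚ < p ^ suc n
1<^ {p} zero    1<p = subst (1ℚ <_) (sym (*-identityʳ p)) 1<p
1<^ {p} (suc n) 1<p = <-trans 1<p
  (subst (_< p * p ^ suc n) (*-identityʳ p) (*-strictˡ (<-trans 0<1ℚ 1<p) (1<^ n 1<p)))

bernoulli-step : ∀ {k u p} → 0ℚ ≤ k → 0ℚ ≤ 1ℚ + u → 1ℚ + k * u ≤ p →
                 1ℚ + (1ℚ + k) * u ≤ (1ℚ + u) * p
bernoulli-step {k} {u} {p} 0≤k 0≤1+u h = begin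
  1ℚ + (1ℚ + k) * u                ≡⟨ +-identityʳ (1ℚ + (1ℚ + k) * u) ⟨
  1ℚ + (1ℚ + k) * u + 0ℚ           ≤⟨ +-monoʳ-≤ (1ℚ + (1ℚ + k) * u) (0≤* 0≤k (0≤p*p u)) ⟩
  1ℚ + (1ℚ + k) * u + k * (u * u)  ≡⟨ solve 2 (λ k u → con 1ℚ :+ (con 1ℚ :+ k) :* u :+ k :* (u :* u)
                                        := (con 1ℚ :+ u) :* (con 1ℚ :+ k :* u)) refl k u ⟩
  (1ℚ + u) * (1ℚ + k * u)          ≤⟨ *-monoˡ 0≤1+u h ⟩
  (1ℚ + u) * p                     ∎
  where open ≤-Reasoning

bernoulli : ∀ n u → 0ℚ ≤ 1ℚ + u → 1ℚ + ι n * u ≤ (1ℚ + u) ^ n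
bernoulli zero    u 0≤1+u = ≤-reflexive (trans (cong (λ (z : ℚ) → 1ℚ + z) (*-zeroˡ u)) (+-identityʳ 1ℚ))
bernoulli (suc n) u 0≤1+u = subst (λ k → 1ℚ + k * u ≤ (1ℚ + u) ^ suc n) (sym (ι-+ 1 n))
  (bernoulli-step (0≤ι n) 0≤1+u (bernoulli n u 0≤1+u))

record ℝ : Set₁ where
  field
    L U         : ℚ → Set
    L-inhabited : ∃ L
    U-inhabited : ∃ U
    L-closed    : ∀ {q r} → q < r → L r → L q
    U-closed    : ∀ {q r} → q < r → U q → U r
    L-open      : ∀ {q} → L q → ∃[ r ] q < r × L r
    U-open      : ∀ {r} → U r → ∃[ q ] q < r × U q
    disjoint    : ∀ {q} → L q → ¬ U q
    located     : ∀ {q r} → q < r → L q ⊎ U r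

  L<U : ∀ {q r} → L q → U r → q < r
  L<U {q} {r} Lq Ur with <-cmp q r
  ... | tri< q<r _ _ = q<r
  ... | tri≈ _ refl _ = contradiction Ur (disjoint Lq)
  ... | tri> _ _ r<q = contradiction (U-closed r<q Ur) (disjoint Lq)

open ℝ

infix 4 _<ℝ_ _≤ℝ_ _#ℝ_

_<ℝ_ : ℝ → ℝ → Set
x <ℝ y = ∃[ q ] U x q × L y q

_≤ℝ_ : ℝ → ℝ → Set
x ≤ℝ y = ∀ {q} → L x q → L y q

_#ℝ_ : ℝ → ℝ → Set
x #ℝ y = x <ℝ y ⊎ y <ℝ x

fromℚ : ℚ → ℝ
fromℚ p = record
  { L           = _< p
  ; U           = p <_
  ; L-inhabited = p - 1ℚ , p-q<p 0<1ℚ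
  ; U-inhabited = p + 1ℚ , p<p+q 0<1ℚ
  ; L-closed    = <-trans
  ; U-closed    = λ q<r p<q → <-trans p<q q<r
  ; L-open      = <-dense
  ; U-open      = λ p<r → let q , p<q , q<r = <-dense p<r in q , q<r , p<q
  ; disjoint    = <-asym
  ; located     = loc
  }
  where
  loc : ∀ {q r} → q < r → q < p ⊎ p < r
  loc {q} q<r with <-cmp q p
  ... | tri< q<p _ _  = inj₁ q<p
  ... | tri≈ _ refl _ = inj₂ q<r
  ... | tri> _ _ p<q  = inj₂ (<-trans p<q q<r)

0ℝ : ℝ
0ℝ = fromℚ 0ℚ

fromℕ : ℕ → ℝ
fromℕ n = fromℚ (ι n)

-- The real number sup A = inf B.  A and B themselves need not be rounded
-- or closed downwards and upwards.
cut : (A B : ℚ → Set) → ∃ A → ∃ B →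
      (∀ {a b} → A a → B b → a ≤ b) →
      (∀ {q r} → q < r → A q ⊎ B r) → ℝ
cut A B (a , Aa) (b , Bb) A≤B A∨B = record
  { L           = λ q → ∃[ a ] q < a × A a
  ; U           = λ q → ∃[ b ] b < q × B b
  ; L-inhabited = a - 1ℚ , a , p-q<p 0<1ℚ , Aa
  ; U-inhabited = b + 1ℚ , b , p<p+q 0<1ℚ , Bb
  ; L-closed    = λ q<r (a , r<a , Aa) → a , <-trans q<r r<a , Aa
  ; U-closed    = λ q<r (b , b<q , Bb) → b , <-trans b<q q<r , Bb
  ; L-open      = λ (a , q<a , Aa) → let r , q<r , r<a = <-dense q<a in r , q<r , a , r<a , Aa
  ; U-open      = λ (b , b<r , Bb) → let q , b<q , q<r = <-dense b<r in q , q<r , b , b<q , Bb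
  ; disjoint    = λ (a , q<a , Aa) (b , b<q , Bb) →
                    <-irrefl refl (<-≤-trans (<-trans b<q q<a) (A≤B Aa Bb))
  ; located     = loc
  }
  where
  loc : ∀ {q r} → q < r → (∃[ a ] q < a × A a) ⊎ (∃[ b ] b < r × B b)
  loc q<r with <-dense q<r
  ... | s , q<s , s<r with <-dense s<r
  ... | t , s<t , t<r with A∨B s<t
  ... | inj₁ As = inj₁ (s , q<s , As)
  ... | inj₂ Bt = inj₂ (t , t<r , Bt)

infix 8 -ℝ_

-ℝ_ : ℝ → ℝ
-ℝ x = record
  { L           = λ q → U x (- q)
  ; U           = λ q → L x (- q)
  ; L-inhabited = let q , Uq = U-inhabited x in - q , subst (U x) (sym (neg-involutive q)) Uq
  ; U-inhabited = let q , Lq = L-inhabited x in - q , subst (L x) (sym (neg-involutive q)) Lq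
  ; L-closed    = λ q<r → U-closed x (neg-antimono-< q<r)
  ; U-closed    = λ q<r → L-closed x (neg-antimono-< q<r)
  ; L-open      = λ {q} U-q → let r , r<-q , Ur = U-open x U-q in
                    - r , subst (_< - r) (neg-involutive q) (neg-antimono-< r<-q) ,
                    subst (U x) (sym (neg-involutive r)) Ur
  ; U-open      = λ {q} L-q → let r , -q<r , Lr = L-open x L-q in
                    - r , subst (- r <_) (neg-involutive q) (neg-antimono-< -q<r) ,
                    subst (L x) (sym (neg-involutive r)) Lr
  ; disjoint    = λ Uq Lq → disjoint x Lq Uq
  ; located     = λ q<r → swap (located x (neg-antimono-< q<r))
  }
  where
  neg-involutive : ∀ q → - (- q) ≡ q
  neg-involutive = solve 1 (λ q → :neg (:neg q) := q) refl

module _ (x : ℝ) where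

  private
    step : ∀ p k h → p + (1ℚ + k) * h ≡ (p + h) + k * h
    step = solve 3 (λ p k h → p :+ (con 1ℚ :+ k) :* h := (p :+ h) :+ k :* h) refl

    walk : ∀ h → 0ℚ < h → ∀ n p → L x p → U x (p + ι n * h) →
           ∃[ q ] p ≤ q × L x q × U x (q + (h + h))
    walk h 0<h zero p Lp U0 = contradiction (subst (U x) eq U0) (disjoint x Lp)
      where
      eq : p + 0ℚ * h ≡ p
      eq = trans (cong (λ (z : ℚ) → p + z) (*-zeroˡ h)) (+-identityʳ p)
    walk h 0<h (suc n) p Lp Un with located x (+-monoʳ-< p (p<p+q {h} 0<h))
    ... | inj₂ U2 = p , ≤-refl , Lp , U2
    ... | inj₁ L1 =
      let q , p+h≤q , Lq , Uq = walk h 0<h n (p + h) L1 Un′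
      in  q , ≤-trans (<⇒≤ (p<p+q 0<h)) p+h≤q , Lq , Uq
      where
      Un′ : U x ((p + h) + ι n * h)
      Un′ = subst (U x) (step p (ι n) h) (subst (λ k → U x (p + k * h)) (ι-+ 1 n) Un)

    overshoot : ∀ u p h k (0<h : 0ℚ < h) → (u - p) * recip h 0<h < k → u < p + k * h
    overshoot u p h k 0<h lt = subst₂ _<_ lhs (+-comm (k * h) p)
                                 (+-monoˡ-< p (*-strictʳ 0<h lt))
      where
      lhs : (u - p) * recip h 0<h * h + p ≡ u
      lhs = trans
        (solve 4 (λ u p r h → (u :- p) :* r :* h :+ p := (u :- p) :* (h :* r) :+ p)
          refl u p (recip h 0<h) h)
        (trans (cong (λ (z : ℚ) → (u - p) * z + p) (*-recip h 0<h))
          (solve 2 (λ u p → (u :- p) :* con 1ℚ :+ p := u) refl u p))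

    halves : ∀ e → e * ½ + e * ½ ≡ e
    halves e = trans (sym (*-distribˡ-+ e ½ ½)) (*-identityʳ e)

    overshoots : ∀ {u p h} → 0ℚ < h → U x u → ∃[ n ] U x (p + ι n * h)
    overshoots {u} {p} {h} 0<h Uu = let n , lt = archimedean ((u - p) * recip h 0<h) in
      suc n , U-closed x (overshoot u p h (ι (suc n)) 0<h lt) Uu

  approximate : ∀ {p e} → L x p → 0ℚ < e → ∃[ q ] p ≤ q × L x q × U x (q + e)
  approximate {p} {e} Lp 0<e =
    let n , Un              = overshoots {p = p} 0<h (proj₂ (U-inhabited x))
        q , p≤q , Lq , Uq+e = walk (e * ½) 0<h n p Lp Un
    in  q , p≤q , Lq , subst (λ z → U x (q + z)) (halves e) Uq+e
    where
    0<h : 0ℚ < e * ½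
    0<h = 0<* 0<e (positive⁻¹ ½)

*-convex : ∀ q {c t d} → c ≤ t → t ≤ d → ∀ {a} → q * c ≤ a → q * d ≤ a → q * t ≤ a
*-convex q c≤t t≤d qc≤a qd≤a with ≤-total 0ℚ q
... | inj₁ 0≤q = ≤-trans (*-monoˡ 0≤q t≤d) qd≤a
... | inj₂ q≤0 = ≤-trans (*-monoˡ-≤-nonPos q {{nonPositive q≤0}} c≤t) qc≤a

*-concave : ∀ q {c t d} → c ≤ t → t ≤ d → ∀ {b} → b ≤ q * c → b ≤ q * d → b ≤ q * t
*-concave q c≤t t≤d b≤qc b≤qd with ≤-total 0ℚ q
... | inj₁ 0≤q = ≤-trans b≤qc (*-monoˡ 0≤q c≤t)
... | inj₂ q≤0 = ≤-trans b≤qd (*-monoˡ-≤-nonPos q {{nonPositive q≤0}} t≤d)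

module Division (x y : ℝ) (0<y : 0ℝ <ℝ y) where

  -- If 0 < c < y < d then q c ≤ a and q d ≤ a give q y ≤ a < x,
  -- whatever the sign of q; dually for Above.
  Below Above : ℚ → Set
  Below q = ∃[ a ] ∃[ c ] ∃[ d ] L x a × 0ℚ < c × L y c × U y d × q * c ≤ a × q * d ≤ a
  Above q = ∃[ b ] ∃[ c ] ∃[ d ] U x b × 0ℚ < c × L y c × U y d × b ≤ q * c × b ≤ q * d

  private
    c₀ : ℚ
    c₀ = proj₁ 0<y

    0<c₀ : 0ℚ < c₀
    0<c₀ = proj₁ (proj₂ 0<y)

    Lc₀ : L y c₀
    Lc₀ = proj₂ (proj₂ 0<y)

    Below≤Above : ∀ {q r} → Below q → Above r → q ≤ r
    Below≤Above {q} {r} (a , c , d , La , 0<c , Lc , Ud , qc≤a , qd≤a)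
                        (b , c′ , d′ , Ub , 0<c′ , Lc′ , Ud′ , b≤rc′ , b≤rd′) =
      <⇒≤ (*-cancelʳ {r = t} (<-≤-trans 0<c c≤t) (≤-<-trans
        (*-convex q c≤t (<⇒≤ (L<U y Lt Ud)) qc≤a qd≤a)
        (<-≤-trans (L<U x La Ub)
          (*-concave r c′≤t (<⇒≤ (L<U y Lt Ud′)) b≤rc′ b≤rd′))))
      where
      t = c ⊔ c′
      c≤t : c ≤ t
      c≤t = p≤p⊔q c c′
      c′≤t : c′ ≤ t
      c′≤t = p≤q⊔p c c′
      Lt : L y t
      Lt with ⊔-sel c c′
      ... | inj₁ eq = subst (L y) (sym eq) Lc
      ... | inj₂ eq = subst (L y) (sym eq) Lc′

    gap : ∀ {q r c} → q < r → c₀ ≤ c → ∀ e →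
          e * (∣ q ∣ + ∣ r ∣ + 1ℚ) ≡ (r - q) * c₀ → 0ℚ < e →
          ∀ {s} → s ≤ ∣ q ∣ + ∣ r ∣ → s * e < (r - q) * c
    gap {q} {r} {c} q<r c₀≤c e eM≡ 0<e {s} s≤ = begin-strict
      s * e                        <⟨ *-strictʳ 0<e (≤-<-trans s≤ (p<p+q 0<1ℚ)) ⟩
      (∣ q ∣ + ∣ r ∣ + 1ℚ) * e     ≡⟨ *-comm (∣ q ∣ + ∣ r ∣ + 1ℚ) e ⟩
      e * (∣ q ∣ + ∣ r ∣ + 1ℚ)     ≡⟨ eM≡ ⟩
      (r - q) * c₀                 ≤⟨ *-monoˡ (<⇒≤ (p<q⇒0<q-p q<r)) c₀≤c ⟩
      (r - q) * c                  ∎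
      where open ≤-Reasoning

    cross₁ : ∀ q r c e → q * e < (r - q) * c → q * (c + e) < r * c
    cross₁ q r c e lt = 0<q-p⇒p<q (subst (0ℚ <_)
      (solve 4 (λ q r c e → (r :- q) :* c :- q :* e := r :* c :- q :* (c :+ e)) refl q r c e)
      (p<q⇒0<q-p lt))

    cross₂ : ∀ q r c e → (- r) * e < (r - q) * c → q * c < r * (c + e)
    cross₂ q r c e lt = 0<q-p⇒p<q (subst (0ℚ <_)
      (solve 4 (λ q r c e → (r :- q) :* c :- (:neg r) :* e := r :* (c :+ e) :- q :* c) refl q r c e)
      (p<q⇒0<q-p lt))

    fine : ∀ {q r} → q < r →
           ∃[ e ] 0ℚ < e × e * (∣ q ∣ + ∣ r ∣ + 1ℚ) ≡ (r - q) * c₀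
    fine {q} {r} q<r = (r - q) * c₀ * recip M 0<M
                     , 0<* (0<* (p<q⇒0<q-p q<r) 0<c₀) (0<recip M 0<M)
                     , eq ((r - q) * c₀) M (recip M 0<M) (*-recip M 0<M)
      where
      M : ℚ
      M = ∣ q ∣ + ∣ r ∣ + 1ℚ
      0<M : 0ℚ < M
      0<M = ≤-<-trans (+-mono-≤ (0≤∣p∣ q) (0≤∣p∣ r)) (p<p+q 0<1ℚ)
      eq : ∀ p m i → m * i ≡ 1ℚ → p * i * m ≡ p
      eq p m i m*i≡1 = trans (solve 3 (λ p m i → p :* i :* m := p :* (m :* i)) refl p m i)
        (trans (cong (λ (z : ℚ) → p * z) m*i≡1) (*-identityʳ p))

    straddle : ∀ {q r c e} → q < r → 0ℚ < c → 0ℚ < e →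
               q * e < (r - q) * c → (- r) * e < (r - q) * c →
               q * c ⊔ q * (c + e) < (r * c) ⊓ (r * (c + e))
    straddle {q} {r} {c} {e} q<r 0<c 0<e qe< -re< = ⊓-glb-< (r * c) (r * (c + e))
      (⊔-lub-< (q * c) (q * (c + e)) (*-strictʳ 0<c q<r) (cross₁ q r c e qe<))
      (⊔-lub-< (q * c) (q * (c + e)) (cross₂ q r c e -re<) (*-strictʳ (<-trans 0<c (p<p+q 0<e)) q<r))

    ∣q∣+∣r∣-bounds : ∀ q r → q ≤ ∣ q ∣ + ∣ r ∣ × - r ≤ ∣ q ∣ + ∣ r ∣
    ∣q∣+∣r∣-bounds q r
      = subst (_≤ ∣ q ∣ + ∣ r ∣) (+-identityʳ q) (+-mono-≤ (p≤∣p∣ q) (0≤∣p∣ r))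
      , subst (_≤ ∣ q ∣ + ∣ r ∣) (+-identityˡ (- r)) (+-mono-≤ (0≤∣p∣ q) (-p≤∣p∣ r))

    decide : ∀ q r c d → 0ℚ < c → L y c → U y d →
             q * c ⊔ q * d < (r * c) ⊓ (r * d) → Below q ⊎ Above r
    decide q r c d 0<c Lc Ud lt = Sum.map
      (λ La → q * c ⊔ q * d , c , d , La , 0<c , Lc , Ud , p≤p⊔q (q * c) (q * d) , p≤q⊔p (q * c) (q * d))
      (λ Ub → (r * c) ⊓ (r * d) , c , d , Ub , 0<c , Lc , Ud , p⊓q≤p (r * c) (r * d) , p⊓q≤q (r * c) (r * d))
      (located x lt)

    Below∨Above : ∀ {q r} → q < r → Below q ⊎ Above r
    Below∨Above {q} {r} q<r =
      let e , 0<e , eM≡       = fine q<r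
          c , c₀≤c , Lc , Ud  = approximate y Lc₀ 0<e
          0<c                 = <-≤-trans 0<c₀ c₀≤c
          q≤ , -r≤            = ∣q∣+∣r∣-bounds q r
      in  decide q r c (c + e) 0<c Lc Ud
            (straddle q<r 0<c 0<e (gap q<r c₀≤c e eM≡ 0<e q≤) (gap q<r c₀≤c e eM≡ 0<e -r≤))

    c₀≤d : ∀ {d} → U y d → c₀ ≤ d
    c₀≤d Ud = <⇒≤ (L<U y Lc₀ Ud)

    scale : ∀ p → p * recip c₀ 0<c₀ * c₀ ≡ p
    scale p = trans (*-assoc p (recip c₀ 0<c₀) c₀)
      (trans (cong (λ (z : ℚ) → p * z) (trans (*-comm (recip c₀ 0<c₀) c₀) (*-recip c₀ 0<c₀)))
        (*-identityʳ p))

    0≤scaled : ∀ p → 0ℚ ≤ ∣ p ∣ * recip c₀ 0<c₀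
    0≤scaled p = 0≤* (0≤∣p∣ p) (<⇒≤ (0<recip c₀ 0<c₀))

    ∃Above : ∃ Above
    ∃Above =
      let b , Ub = U-inhabited x
          d , Ud = U-inhabited y
          q      = ∣ b ∣ * recip c₀ 0<c₀
          b≤qc   = subst (b ≤_) (sym (scale ∣ b ∣)) (p≤∣p∣ b)
      in  q , b , c₀ , d , Ub , 0<c₀ , Lc₀ , Ud , b≤qc
        , ≤-trans b≤qc (*-monoˡ (0≤scaled b) (c₀≤d Ud))

    ∃Below : ∃ Below
    ∃Below =
      let a , La = L-inhabited x
          d , Ud = U-inhabited y
          q      = ∣ a ∣ * recip c₀ 0<c₀
          -a≤qc  = subst (- a ≤_) (sym (scale ∣ a ∣)) (-p≤∣p∣ a)
      in  - q , a , c₀ , d , La , 0<c₀ , Lc₀ , Ud , flip a q c₀ -a≤qc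
        , flip a q d (≤-trans -a≤qc (*-monoˡ (0≤scaled a) (c₀≤d Ud)))
      where
      flip : ∀ a q c → - a ≤ q * c → - q * c ≤ a
      flip a q c h = subst₂ _≤_ (solve 2 (λ q c → :neg (q :* c) := (:neg q) :* c) refl q c)
        (solve 1 (λ a → :neg (:neg a) := a) refl a) (neg-antimono-≤ h)

  quotient : ℝ
  quotient = cut Below Above ∃Below ∃Above Below≤Above Below∨Above

negate-<0 : ∀ {y} → y <ℝ 0ℝ → 0ℝ <ℝ -ℝ y
negate-<0 {y} (q , Uq , q<0) = - q , neg-antimono-< q<0
  , subst (U y) (solve 1 (λ q → q := :neg (:neg q)) refl q) Uq

infix 7 _÷ℝ_[_]

_÷ℝ_[_] : (x y : ℝ) → y #ℝ 0ℝ → ℝ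
x ÷ℝ y [ inj₁ y<0 ] = Division.quotient (-ℝ x) (-ℝ y) (negate-<0 {y} y<0)
x ÷ℝ y [ inj₂ 0<y ] = Division.quotient x y 0<y

factor : ℚ → ℕ → ℚ
factor q n = 1ℚ + q * (+ 1 / suc n)

compound : ℚ → ℕ → ℚ
compound q n = factor q n ^ suc n

infix 4 _≤exp_ exp_≤_

-- With m = suc n: if 1 + q/m > 0 then (1 + q/m)^m ≤ e^q, and if
-- 1 - q/m > 0 then e^q ≤ (1 - q/m)^-m; both bounds tend to e^q.
_≤exp_ : ℚ → ℚ → Set
r ≤exp q = ∃[ n ] 0ℚ < factor q n × r ≤ compound q n

exp_≤_ : ℚ → ℚ → Set
exp q ≤ r = ∃[ n ] 0ℚ < factor (- q) n × 1ℚ ≤ r * compound (- q) n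

split-unit : ∀ i j k m n → m * i ≡ 1ℚ → n * j ≡ 1ℚ → n ≡ k * m → i ≡ k * j
split-unit i j k m n mi≡1 nj≡1 n≡km = begin
  i                  ≡⟨ *-identityʳ i ⟨
  i * 1ℚ             ≡⟨ cong (λ (z : ℚ) → i * z) nj≡1 ⟨
  i * (n * j)        ≡⟨ cong (λ (z : ℚ) → i * (z * j)) n≡km ⟩
  i * (k * m * j)    ≡⟨ solve 4 (λ i k m j → i :* (k :* m :* j) := (m :* i) :* (k :* j)) refl i k m j ⟩
  m * i * (k * j)    ≡⟨ cong (λ (z : ℚ) → z * (k * j)) mi≡1 ⟩
  1ℚ * (k * j)       ≡⟨ *-identityˡ (k * j) ⟩
  k * j              ∎
  where open ≡-Reasoning

factor-split : ∀ q m k n → suc n ≡ suc k ℕ.* suc m →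
               factor q m ≡ 1ℚ + ι (suc k) * (q * (+ 1 / suc n))
factor-split q m k n eq = cong (λ (z : ℚ) → 1ℚ + z) (trans
  (cong (λ (z : ℚ) → q * z)
    (split-unit (+ 1 / suc m) (+ 1 / suc n) (ι (suc k)) (ι (suc m)) (ι (suc n)) (ι-*-1/ m) (ι-*-1/ n) (trans (cong ι eq) (ι-* (suc k) (suc m)))))
  (swap-* q (ι (suc k)) (+ 1 / suc n)))
  where
  swap-* : ∀ p q r → p * (q * r) ≡ q * (p * r)
  swap-* = solve 3 (λ p q r → p :* (q :* r) := q :* (p :* r)) refl

shrink : ∀ k u → 1ℚ ≤ k → 0ℚ < 1ℚ + k * u → 0ℚ < 1ℚ + u
shrink k u 1≤k 0<1+ku with ≤-total 0ℚ u
... | inj₁ 0≤u = <-≤-trans 0<1ℚ (subst (_≤ 1ℚ + u) (+-identityʳ 1ℚ) (+-monoʳ-≤ 1ℚ 0≤u))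
... | inj₂ u≤0 = <-≤-trans 0<1+ku (+-monoʳ-≤ 1ℚ
  (subst (k * u ≤_) (*-identityˡ u) (*-monoʳ-≤-nonPos u {{nonPositive u≤0}} 1≤k)))

1≤ι : ∀ k → 1ℚ ≤ ι (suc k)
1≤ι k = subst (1ℚ ≤_) (sym (ι-+ 1 k))
  (subst (_≤ 1ℚ + ι k) (+-identityʳ 1ℚ) (+-monoʳ-≤ 1ℚ (0≤ι k)))

refine : ∀ q m k n → suc n ≡ suc k ℕ.* suc m → 0ℚ < factor q m →
         0ℚ < factor q n × compound q m ≤ compound q n
refine q m k n eq 0<fm = 0<1+u , (begin
  factor q m ^ suc m                    ≤⟨ ^-mono (suc m) (<⇒≤ 0<fm) fm≤ ⟩
  (factor q n ^ suc k) ^ suc m          ≡⟨ ^-assocʳ (factor q n) (suc k) (suc m) ⟩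
  factor q n ^ (suc k ℕ.* suc m)        ≡⟨ cong (factor q n ^_) eq ⟨
  factor q n ^ suc n                    ∎)
  where
  open ≤-Reasoning
  u = q * (+ 1 / suc n)
  0<1+u : 0ℚ < factor q n
  0<1+u = shrink (ι (suc k)) u (1≤ι k) (subst (0ℚ <_) (factor-split q m k n eq) 0<fm)
  fm≤ : factor q m ≤ factor q n ^ suc k
  fm≤ = subst (_≤ factor q n ^ suc k) (sym (factor-split q m k n eq))
    (bernoulli (suc k) u (<⇒≤ 0<1+u))

factors≤1 : ∀ q i → (1ℚ + q * i) * (1ℚ + (- q) * i) ≤ 1ℚ
factors≤1 q i = subst₂ _≤_
  (solve 2 (λ q i → con 1ℚ :- (q :* i) :* (q :* i)
     := (con 1ℚ :+ q :* i) :* (con 1ℚ :+ (:neg q) :* i)) refl q i)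
  (+-identityʳ 1ℚ)
  (+-monoʳ-≤ 1ℚ (neg-antimono-≤ (0≤p*p (q * i))))

compounds≤1 : ∀ q m n → 0ℚ < factor q m → 0ℚ < factor (- q) n →
              compound q m * compound (- q) n ≤ 1ℚ
compounds≤1 q m n 0<fm 0<fn =
  let k          = m ℕ.+ n ℕ.* suc m
      0<f₁ , c₁≤ = refine q m n k refl 0<fm
      0<f₂ , c₂≤ = refine (- q) n m k (ℕₚ.*-comm (suc n) (suc m)) 0<fn
  in begin
    compound q m * compound (- q) n             ≤⟨ *-mono (0≤^ (suc m) (<⇒≤ 0<fm)) (0≤^ (suc n) (<⇒≤ 0<fn)) c₁≤ c₂≤ ⟩
    compound q k * compound (- q) k             ≡⟨ ^-distrib-* (factor q k) (factor (- q) k) (suc k) ⟨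
    (factor q k * factor (- q) k) ^ suc k       ≤⟨ ^-≤1 (suc k) (<⇒≤ (0<* 0<f₁ 0<f₂)) (factors≤1 q (+ 1 / suc k)) ⟩
    1ℚ                                          ∎
  where open ≤-Reasoning

0<1+ : ∀ q i n → n * i ≡ 1ℚ → 0ℚ < i → - q < n → 0ℚ < 1ℚ + q * i
0<1+ q i n ni≡1 0<i -q<n = subst (0ℚ <_)
  (trans (solve 3 (λ q i n → (n :- (:neg q)) :* i := n :* i :+ q :* i) refl q i n)
    (cong (λ (z : ℚ) → z + q * i) ni≡1))
  (0<* (p<q⇒0<q-p -q<n) 0<i)

1<factors : ∀ q r i n → n * i ≡ 1ℚ → 0ℚ < i → q * r < (r - q) * n →
            1ℚ < (1ℚ + r * i) * (1ℚ + (- q) * i)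
1<factors q r i n ni≡1 0<i lt = 0<q-p⇒p<q (subst (0ℚ <_) eq (0<* (0<* (p<q⇒0<q-p lt) 0<i) 0<i))
  where
  eq : ((r - q) * n - q * r) * i * i ≡ (1ℚ + r * i) * (1ℚ + (- q) * i) - 1ℚ
  eq = trans
    (solve 4 (λ q r i n → ((r :- q) :* n :- q :* r) :* i :* i
       := (r :- q) :* (n :* i) :* i :- (q :* r) :* i :* i) refl q r i n)
    (trans (cong (λ (z : ℚ) → (r - q) * z * i - q * r * i * i) ni≡1)
      (solve 3 (λ q r i → (r :- q) :* con 1ℚ :* i :- (q :* r) :* i :* i
         := (con 1ℚ :+ r :* i) :* (con 1ℚ :+ (:neg q) :* i) :- con 1ℚ) refl q r i))

large : ∀ {q r} → q < r →
        ∃[ n ] q < ι (suc n) × - r < ι (suc n) × q * r < (r - q) * ι (suc n)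
large {q} {r} q<r =
  let n , lt = archimedean (q ⊔ - r ⊔ s)
  in  n
    , ≤-<-trans (≤-trans (p≤p⊔q q (- r)) (p≤p⊔q (q ⊔ - r) s)) lt
    , ≤-<-trans (≤-trans (p≤q⊔p q (- r)) (p≤p⊔q (q ⊔ - r) s)) lt
    , clear (r - q) (q * r) (ι (suc n)) 0<r-q (≤-<-trans (p≤q⊔p (q ⊔ - r) s) lt)
  where
  0<r-q : 0ℚ < r - q
  0<r-q = p<q⇒0<q-p q<r
  s : ℚ
  s = q * r * recip (r - q) 0<r-q
  clear : ∀ d p n (0<d : 0ℚ < d) → p * recip d 0<d < n → p < d * n
  clear d p n 0<d lt = subst (_< d * n)
    (trans (solve 3 (λ d p i → d :* (p :* i) := p :* (d :* i)) refl d p (recip d 0<d))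
      (trans (cong (λ (z : ℚ) → p * z) (*-recip d 0<d)) (*-identityʳ p)))
    (*-strictˡ 0<d lt)

module Logarithm (x : ℝ) (0<x : 0ℝ <ℝ x) where

  -- e^q ≤ r < x, respectively x < r ≤ e^q, for some rational r.
  Below Above : ℚ → Set
  Below q = ∃[ r ] L x r × exp q ≤ r
  Above q = ∃[ r ] U x r × r ≤exp q

  private
    1+r-1 : ∀ r → factor (r - 1ℚ) 0 ≡ r
    1+r-1 = solve 1 (λ r → con 1ℚ :+ (r :- con 1ℚ) :* con 1ℚ := r) refl

    ^1 : ∀ r → r ^ 1 ≡ r
    ^1 = *-identityʳ

    ∃Above : ∃ Above
    ∃Above =
      let r , Ur = U-inhabited x
          eq     = sym (1+r-1 r)
      in  r - 1ℚ , r , Ur , 0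
        , subst (0ℚ <_) eq (<-trans (proj₁ (proj₂ 0<x)) (L<U x (proj₂ (proj₂ 0<x)) Ur))
        , subst (r ≤_) (trans eq (sym (^1 (factor (r - 1ℚ) 0)))) ≤-refl

    ∃Below : ∃ Below
    ∃Below =
      let r , 0<r , Lr = 0<x
          i            = recip r 0<r
          eq           = sym (trans (cong (λ q → factor q 0) (flip i)) (1+r-1 i))
      in  1ℚ - i , r , Lr , 0
        , subst (0ℚ <_) eq (0<recip r 0<r)
        , ≤-reflexive (sym (trans
            (cong (λ (z : ℚ) → r * z) (trans (^1 (factor (- (1ℚ - i)) 0)) (sym eq)))
            (*-recip r 0<r)))
      where
      flip : ∀ i → - (1ℚ - i) ≡ i - 1ℚ
      flip = solve 1 (λ i → :neg (con 1ℚ :- i) := i :- con 1ℚ) refl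

    factor-mono : ∀ q r n → q ≤ r → factor q n ≤ factor r n
    factor-mono q r n q≤r = +-monoʳ-≤ 1ℚ (*-monoʳ (<⇒≤ (0<1/ n)) q≤r)

    Below≤Above : ∀ {q r} → Below q → Above r → q ≤ r
    Below≤Above {q} {r} (a , La , n , 0<fn , 1≤) (b , Ub , m , 0<fm , b≤) =
      ≮⇒≥ λ r<q → <-irrefl refl (begin-strict
        1ℚ                                 ≤⟨ 1≤ ⟩
        a * compound (- q) n               <⟨ *-strictʳ (0<^ (suc n) 0<fn) (L<U x La Ub) ⟩
        b * compound (- q) n               ≤⟨ *-monoʳ (0≤^ (suc n) (<⇒≤ 0<fn)) b≤ ⟩
        compound r m * compound (- q) n    ≤⟨ *-monoʳ (0≤^ (suc n) (<⇒≤ 0<fn))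
                                               (^-mono (suc m) (<⇒≤ 0<fm) (factor-mono r q m (<⇒≤ r<q))) ⟩
        compound q m * compound (- q) n    ≤⟨ compounds≤1 q m n (<-≤-trans 0<fm (factor-mono r q m (<⇒≤ r<q))) 0<fn ⟩
        1ℚ                                 ∎)
      where open ≤-Reasoning

    separate : ∀ {p s} (0<p : 0ℚ < p) → 1ℚ < s * p → recip p 0<p < s
    separate {p} {s} 0<p lt = *-cancelʳ 0<p
      (subst (_< s * p) (sym (trans (*-comm (recip p 0<p) p) (*-recip p 0<p))) lt)

    Below∨Above : ∀ {q r} → q < r → Below q ⊎ Above r
    Below∨Above {q} {r} q<r =
      let n , q<n , -r<n , lt = large q<r
          i    = + 1 / suc n
          0<fr = 0<1+ r i (ι (suc n)) (ι-*-1/ n) (0<1/ n) -r<n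
          0<fq = 0<1+ (- q) i (ι (suc n)) (ι-*-1/ n) (0<1/ n)
                   (subst (_< ι (suc n)) (sym (neg-involutive q)) q<n)
          p    = compound (- q) n
          0<p  = 0<^ (suc n) 0<fq
          1<   = subst (1ℚ <_) (^-distrib-* (factor r n) (factor (- q) n) (suc n))
                   (1<^ n (1<factors q r i (ι (suc n)) (ι-*-1/ n) (0<1/ n) lt))
      in  Sum.map
            (λ La → recip p 0<p , La , n , 0<fq
                  , ≤-reflexive (sym (trans (*-comm (recip p 0<p) p) (*-recip p 0<p))))
            (λ Ub → compound r n , Ub , n , 0<fr , ≤-refl)
            (located x (separate {p} {compound r n} 0<p 1<))
      where
      neg-involutive : ∀ q → - (- q) ≡ q
      neg-involutive = solve 1 (λ q → :neg (:neg q) := q) refl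

  logarithm : ℝ
  logarithm = cut Below Above ∃Below ∃Above Below≤Above Below∨Above

-- L and U of the result do not depend on the proof of 0 < x.
log : (x : ℝ) → 0ℝ <ℝ x → ℝ
log = Logarithm.logarithm

{-# OPTIONS --safe #-}
module Submission where

open import Algebra.Bundles using (CommutativeRing)
open import Data.Digit using (Decimal; Expansion; fromDigits)
open import Data.Fin.Base as Fin using (toℕ; fromℕ<)
open import Data.Fin.Properties using (toℕ<n; toℕ-fromℕ<)
open import Data.Integer.Base using (+_)
open import Data.List.Base
  using (List; []; _∷_; [_]; _++_; length; map; reverse; upTo; applyUpTo; cartesianProductWith)
open import Data.List.Membership.Propositional using (_∈_)
open import Data.List.Membership.Propositional.Properties
  using (∈-++⁺ˡ; ∈-++⁺ʳ; ∈-upTo⁺; ∈-applyUpTo⁺; ∈-cartesianProductWith⁺)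
open import Data.List.Properties
  using (++-assoc; ++-identityʳ; reverse-++; length-++; length-map; length-upTo; length-applyUpTo)
import Data.List.Relation.Binary.Infix.Heterogeneous as Infix
import Data.List.Relation.Binary.Infix.Heterogeneous.Properties as Infix
import Data.List.Relation.Binary.Pointwise as Pointwise
open import Data.List.Relation.Unary.All using (_∷_)
open import Data.List.Relation.Unary.Any using (here; there)
open import Data.Nat.Base hiding (_/_)
open import Data.Nat.Combinatorics using (_C_; nCk≡n!/k![n-k]!; k![n∸k]!∣n!)
open import Data.Nat.Coprimality using (Coprime; coprime-divisor)
open import Data.Nat.Divisibility
open import Data.Nat.DivMod
  using (_mod_; m/n*n≡m; m≡m%n+[m/n]*n; m%n<n; m/n<m; m≥n⇒m/n>0; m<n*o⇒m/o<n)
  renaming (_/_ to _/ℕ_)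
open import Data.Nat.Induction using (<-rec)
open import Data.Nat.ListAction using (product)
open import Data.Nat.Primality
open import Data.Nat.Primality.Factorisation using (factorise)
open import Data.Nat.Properties
open import Data.Nat.Tactic.RingSolver using (solve-∀)
open import Data.Product.Base using (_×_; _,_; ∃-syntax; Σ-syntax)
open import Data.Rational.Base using (ℚ; 0ℚ; 1ℚ; ½; _/_)
  renaming (_+_ to _+ℚ_; _*_ to _*ℚ_; -_ to -ℚ_; _≤_ to _≤ℚ_; _<_ to _<ℚ_)
import Data.Rational.Properties as ℚ
open import Data.Rational.Solver using (module +-*-Solver)
open import Data.Sum.Base using (_⊎_; inj₁; inj₂)
open import Data.Vec.Base using (Vec; toList)
open import Data.Vec.Properties using (length-toList)
open import Relation.Binary.Definitions using (tri<; tri≈; tri>)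
open import Relation.Binary.PropositionalEquality hiding ([_])
open import Relation.Nullary.Decidable using (yes; no; toWitness)
open import Relation.Nullary.Negation using (¬_; contradiction)

open import Algebra.Definitions.RawSemiring ℚ.+-*-rawSemiring using () renaming (_^_ to _^ℚ_)
open import Algebra.Properties.CommutativeSemiring.Exp
  (CommutativeRing.commutativeSemiring ℚ.+-*-commutativeRing) using (^-distrib-*; ^-assocʳ)

open import Defs
  using (IsDecimalRepresentation; decimal; _Contains_; ℝ; 0ℝ; fromℕ; fromℚ;
         _<ℝ_; _≤ℝ_; _#ℝ_; _÷ℝ_[_]; log; factor; compound;
         ι; ι-+; ι-*; ι-*-1/; 0<ι; 0≤ι; p<p+q; ^-mono; *-monoˡ; *-monoʳ; *-strictˡ; 0≤*)
open ℝ

-- Put B = 10^l and W = B - 1.  Among the numbers below N = B^t, at most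
-- 1 + W + ... + W^t do not contain S as one of their base-B digits (below the
-- leading one), whereas Chebyshev's bound, in Nair's form, gives about
-- N / log N primes below N.  Since (1 - 1/B)^B ≤ 1/2, the primes win for
-- t = 10 l B, even after the numbers below 8^97 are discarded.  The resulting
-- prime p has log p ≤ 25 l² B, as log 10 ≤ 5/2, and log log p ≥ 4.39, as
-- p ≥ 2^291; and 25 ≤ 5.7 · 4.39.

-- Leibniz's harmonic triangle.

-- The reciprocals of these numbers form Leibniz's harmonic triangle; 1 / `leibniz a b` is the
-- integral of x^a (1 - x)^b over [0, 1].
leibniz : ℕ → ℕ → ℕ
leibniz a b = suc (a + b) * ((a + b) C a)

leibniz-! : ∀ a b → leibniz a b * (a ! * b !) ≡ suc (a + b) !
leibniz-! a b = trans (*-assoc (suc (a + b)) ((a + b) C a) (a ! * b !))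
  (cong (suc (a + b) *_) binomial-!)
  where
  a≤a+b = m≤m+n a b
  instance
    _ = a !* (a + b ∸ a) !≢0
  binomial-! : ((a + b) C a) * (a ! * b !) ≡ (a + b) !
  binomial-! = trans
    (cong₂ (λ z c → z * (a ! * c !)) (nCk≡n!/k![n-k]! a≤a+b) (sym (m+n∸m≡n a b)))
    (m/n*n≡m (k![n∸k]!∣n! a≤a+b))

leibniz-nonZero : ∀ a b → NonZero (leibniz a b)
leibniz-nonZero a b = ≢-nonZero λ eq →
  ≢-nonZero⁻¹ (suc (a + b) !) {{suc (a + b) !≢0}}
    (trans (sym (leibniz-! a b)) (cong (_* (a ! * b !)) eq))

leibniz-sucˡ : ∀ a b → suc a * leibniz (suc a) b ≡ suc (suc (a + b)) * leibniz a b
leibniz-sucˡ a b = *-cancelʳ-≡ _ _ (a ! * b !) {{a !* b !≢0}} (begin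
  suc a * leibniz (suc a) b * (a ! * b !)             ≡⟨ move (suc a) (leibniz (suc a) b) (a !) (b !) ⟩
  leibniz (suc a) b * (suc a ! * b !)                 ≡⟨ leibniz-! (suc a) b ⟩
  suc (suc (a + b)) * suc (a + b) !                   ≡⟨ cong (suc (suc (a + b)) *_) (leibniz-! a b) ⟨
  suc (suc (a + b)) * (leibniz a b * (a ! * b !))     ≡⟨ *-assoc (suc (suc (a + b))) (leibniz a b) (a ! * b !) ⟨
  suc (suc (a + b)) * leibniz a b * (a ! * b !)       ∎)
  where
  open ≡-Reasoning
  move : ∀ s x p q → s * x * (p * q) ≡ x * (s * p * q)
  move = solve-∀

leibniz-comm : ∀ a b → leibniz a b ≡ leibniz b a
leibniz-comm a b = *-cancelʳ-≡ _ _ (a ! * b !) {{a !* b !≢0}} (begin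
  leibniz a b * (a ! * b !)     ≡⟨ leibniz-! a b ⟩
  suc (a + b) !                 ≡⟨ cong (λ n → suc n !) (+-comm a b) ⟩
  suc (b + a) !                 ≡⟨ leibniz-! b a ⟨
  leibniz b a * (b ! * a !)     ≡⟨ cong (leibniz b a *_) (*-comm (b !) (a !)) ⟩
  leibniz b a * (a ! * b !)     ∎)
  where open ≡-Reasoning

leibniz-sucʳ : ∀ a b → suc b * leibniz a (suc b) ≡ suc (suc (a + b)) * leibniz a b
leibniz-sucʳ a b = begin
  suc b * leibniz a (suc b)            ≡⟨ cong (suc b *_) (leibniz-comm a (suc b)) ⟩
  suc b * leibniz (suc b) a            ≡⟨ leibniz-sucˡ b a ⟩
  suc (suc (b + a)) * leibniz b a      ≡⟨ cong₂ (λ n x → suc (suc n) * x) (+-comm b a) (leibniz-comm b a) ⟩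
  suc (suc (a + b)) * leibniz a b      ∎
  where open ≡-Reasoning

leibniz-0 : ∀ b → leibniz 0 b ≡ suc b
leibniz-0 b = *-cancelʳ-≡ _ _ (0 ! * b !) {{0 !* b !≢0}}
  (trans (leibniz-! 0 b) (cong (suc b *_) (sym (*-identityˡ (b !)))))

-- 1/L(a,b) = 1/L(a+1,b) + 1/L(a,b+1), cleared of denominators.
leibniz-harmonic : ∀ a b →
  leibniz a b * (leibniz (suc a) b + leibniz a (suc b)) ≡ leibniz (suc a) b * leibniz a (suc b)
leibniz-harmonic a b = *-cancelʳ-≡ _ _ (suc a * suc b) (begin
  x * (y + z) * (suc a * suc b)                      ≡⟨ expand x y z (suc a) (suc b) ⟩
  x * (suc b * (suc a * y) + suc a * (suc b * z))    ≡⟨ cong₂ (λ u v → x * (suc b * u + suc a * v)) y≡ z≡ ⟩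
  x * (suc b * (c * x) + suc a * (c * x))            ≡⟨ collect x c (suc a) (suc b) ⟩
  (suc a + suc b) * x * (c * x)                      ≡⟨ cong (λ d → suc d * x * (c * x)) (+-suc a b) ⟩
  c * x * (c * x)                                    ≡⟨ cong₂ _*_ y≡ z≡ ⟨
  suc a * y * (suc b * z)                            ≡⟨ regroup (suc a) (suc b) y z ⟩
  y * z * (suc a * suc b)                            ∎)
  where
  open ≡-Reasoning
  x = leibniz a b
  y = leibniz (suc a) b
  z = leibniz a (suc b)
  c = suc (suc (a + b))
  y≡ = leibniz-sucˡ a b
  z≡ = leibniz-sucʳ a b
  expand : ∀ x y z p q → x * (y + z) * (p * q) ≡ x * (q * (p * y) + p * (q * z))
  expand = solve-∀
  collect : ∀ x c p q → x * (q * (c * x) + p * (c * x)) ≡ (p + q) * x * (c * x)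
  collect = solve-∀
  regroup : ∀ p q y z → p * y * (q * z) ≡ y * z * (p * q)
  regroup = solve-∀

-- If D = ix = jz, then D/y = D/x - D/z = i - j.
harmonic-∣ : ∀ {x y z D} .{{_ : NonZero x}} .{{_ : NonZero z}} →
             x * (y + z) ≡ y * z → x ∣ D → z ∣ D → y ∣ D
harmonic-∣ {x} {y} {z} {D} eq (divides i D≡ix) (divides j D≡jz) =
  divides (i ∸ j) (*-cancelʳ-≡ _ _ (x * z) {{m*n≢0 x z}} (begin
    D * (x * z)                       ≡⟨ cong (D *_) xz≡ ⟩
    D * (y * z ∸ x * y)               ≡⟨ *-distribˡ-∸ D (y * z) (x * y) ⟩
    D * (y * z) ∸ D * (x * y)         ≡⟨ cong₂ (λ d e → d * (y * z) ∸ e * (x * y)) D≡ix D≡jz ⟩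
    i * x * (y * z) ∸ j * z * (x * y) ≡⟨ cong₂ _∸_ (shuffleˡ i x y z) (shuffleʳ j x y z) ⟩
    i * (y * (x * z)) ∸ j * (y * (x * z))  ≡⟨ *-distribʳ-∸ (y * (x * z)) i j ⟨
    (i ∸ j) * (y * (x * z))           ≡⟨ *-assoc (i ∸ j) y (x * z) ⟨
    (i ∸ j) * y * (x * z)             ∎))
  where
  open ≡-Reasoning
  xz≡ : x * z ≡ y * z ∸ x * y
  xz≡ = sym (trans (cong (_∸ x * y) (trans (sym eq) (*-distribˡ-+ x y z))) (m+n∸m≡n (x * y) (x * z)))
  shuffleˡ : ∀ i x y z → i * x * (y * z) ≡ i * (y * (x * z))
  shuffleˡ = solve-∀
  shuffleʳ : ∀ j x y z → j * z * (x * y) ≡ j * (y * (x * z))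
  shuffleʳ = solve-∀

-- Induction on `a`: the harmonic relation makes 1 / L(a+1,b) the difference of 1 / L(a,b) and 1 /
-- L(a,b+1). The column a = 0 holds the numbers b + 1, and the index sum never grows, so divisors up
-- to `N` suffice.
leibniz-∣ : ∀ {N D} → (∀ m → .{{NonZero m}} → m ≤ N → m ∣ D) →
            ∀ a b → a + b < N → leibniz a b ∣ D
leibniz-∣ {D = D} div zero    b b<N = subst (_∣ D) (sym (leibniz-0 b)) (div (suc b) b<N)
leibniz-∣ {N}     div (suc a) b lt  = harmonic-∣ {{leibniz-nonZero a b}} {{leibniz-nonZero a (suc b)}}
  (leibniz-harmonic a b)
  (leibniz-∣ div a b (≤-trans (n≤1+n (suc (a + b))) lt))
  (leibniz-∣ div a (suc b) (subst (_< N) (sym (+-suc a b)) lt))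

-- From n to n + 1 the central entry grows by the factor (2n + 3)(2n + 2) / (n + 1)^2 = 4 + 2 / (n +
-- 1).
4^n≤leibniz : ∀ n → 4 ^ n ≤ leibniz n n
4^n≤leibniz zero    = ≤-refl
4^n≤leibniz (suc n) = *-cancelˡ-≤ (suc n * suc n) (begin
  suc n * suc n * (4 * 4 ^ n)                    ≤⟨ *-monoʳ-≤ (suc n * suc n) (*-monoʳ-≤ 4 (4^n≤leibniz n)) ⟩
  suc n * suc n * (4 * x)                        ≤⟨ m≤m+n _ _ ⟩
  suc n * suc n * (4 * x) + 2 * (suc n * x)      ≡⟨ expand n x ⟨
  suc (suc (suc n + n)) * (suc (suc (n + n)) * x)       ≡⟨ cong (suc (suc (suc n + n)) *_) (leibniz-sucˡ n n) ⟨
  suc (suc (suc n + n)) * (suc n * leibniz (suc n) n)   ≡⟨ swap (suc (suc (suc n + n))) (suc n) (leibniz (suc n) n) ⟩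
  suc n * (suc (suc (suc n + n)) * leibniz (suc n) n)   ≡⟨ cong (suc n *_) (leibniz-sucʳ (suc n) n) ⟨
  suc n * (suc n * leibniz (suc n) (suc n))      ≡⟨ *-assoc (suc n) (suc n) _ ⟨
  suc n * suc n * leibniz (suc n) (suc n)        ∎)
  where
  open ≤-Reasoning
  x = leibniz n n
  expand : ∀ n x → suc (suc (suc n + n)) * (suc (suc (n + n)) * x) ≡ suc n * suc n * (4 * x) + 2 * (suc n * x)
  expand = solve-∀
  swap : ∀ p q r → p * (q * r) ≡ q * (p * r)
  swap = solve-∀

-- Common multiples and Chebyshev's lower bound.

∃-prime-divisor : ∀ n → 2 ≤ n → ∃[ p ] Prime p × p ∣ n
∃-prime-divisor n@(suc _) 2≤n with factorise n
... | record { factors = [] ; isFactorisation = refl } = contradiction 2≤n (<-irrefl refl)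
... | record { factors = p ∷ ps ; isFactorisation = eq ; factorsPrime = isPrime ∷ _ } =
  p , isPrime , divides (product ps) (trans eq (*-comm p (product ps)))

prime-power-split : ∀ {p} → Prime p → ∀ m → .{{NonZero m}} →
                    ∃[ v ] ∃[ n ] m ≡ p ^ v * n × ¬ p ∣ n
prime-power-split {p} isPrime = <-rec Split split
  where
  Split : ℕ → Set
  Split m = .{{NonZero m}} → ∃[ v ] ∃[ n ] m ≡ p ^ v * n × ¬ p ∣ n
  split : ∀ m → (∀ {k} → k < m → Split k) → Split m
  split m rec with p ∣? m
  ... | no p∤m = 0 , m , sym (*-identityˡ m) , p∤m
  ... | yes (divides k refl) =
    let instance
          _ = m*n≢0⇒m≢0 k
          _ = prime⇒nonTrivial isPrime
        v , n , k≡ , p∤n = rec (m<m*n k p (nonTrivial⇒n>1 p))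
    in  suc v , n , trans (cong (_* p) k≡) (rotate (p ^ v) n p) , p∤n
    where
    rotate : ∀ q n p → q * n * p ≡ p * q * n
    rotate = solve-∀

¬∣⇒coprime : ∀ {p n} → Prime p → ¬ p ∣ n → Coprime n p
¬∣⇒coprime isPrime p∤n (d∣n , d∣p) with prime⇒irreducible isPrime d∣p
... | inj₁ d≡1  = d≡1
... | inj₂ refl = contradiction d∣n p∤n

coprime-power-divisor : ∀ {p n k} → Prime p → ¬ p ∣ n → ∀ v → n ∣ p ^ v * k → n ∣ k
coprime-power-divisor         isPrime p∤n zero    n∣ = subst (_ ∣_) (*-identityˡ _) n∣
coprime-power-divisor {p} {n} {k} isPrime p∤n (suc v) n∣ =
  coprime-power-divisor isPrime p∤n v
    (coprime-divisor (¬∣⇒coprime isPrime p∤n) (subst (n ∣_) (*-assoc p (p ^ v) k) n∣))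

-- Strong induction. With m = p^v n and p not dividing n, the hypothesis gives D = p^v k and
-- induction gives that n divides D; being coprime to p, n then divides k.
prime-powers-∣⇒∣ : ∀ {D} m → .{{NonZero m}} →
                   (∀ {p} → Prime p → ∀ v → p ^ v ∣ m → p ^ v ∣ D) → m ∣ D
prime-powers-∣⇒∣ {D} = <-rec Div div
  where
  Div : ℕ → Set
  Div m = .{{NonZero m}} → (∀ {p} → Prime p → ∀ v → p ^ v ∣ m → p ^ v ∣ D) → m ∣ D
  div : ∀ m → (∀ {k} → k < m → Div k) → Div m
  div 1 rec h = 1∣ D
  div m@(2+ _) rec h with ∃-prime-divisor m (s≤s (s≤s z≤n))
  ... | p , isPrime , p∣m with prime-power-split isPrime m
  ... | zero  , n , m≡ , p∤n = contradiction (subst (p ∣_) (trans m≡ (*-identityˡ n)) p∣m) p∤n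
  ... | suc v , n , m≡ , p∤n with h isPrime (suc v) (divides n (trans m≡ (*-comm _ n)))
  ... | divides k D≡ = subst₂ _∣_ (sym m≡) (trans (*-comm (p ^ suc v) k) (sym D≡))
        (*-monoʳ-∣ (p ^ suc v) n∣k)
    where
    n∣m : n ∣ m
    n∣m = divides (p ^ suc v) m≡
    instance
      _ = prime⇒nonTrivial isPrime
      _ = prime⇒nonZero isPrime
      n≢0 : NonZero n
      n≢0 = m*n≢0⇒n≢0 (p ^ suc v) {{subst NonZero m≡ _}}
    n<m : n < m
    n<m = subst (n <_) (trans (*-comm n _) (sym m≡))
      (m<m*n n (p ^ suc v) (≤-trans (nonTrivial⇒n>1 p) (m≤m*n p (p ^ v) {{m^n≢0 p v}})))
    n∣k : n ∣ k
    n∣k = coprime-power-divisor isPrime p∤n (suc v)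
      (subst (n ∣_) (trans D≡ (*-comm k (p ^ suc v)))
        (rec n<m {{n≢0}} (λ isPrime w p^w∣n → h isPrime w (∣-trans p^w∣n n∣m))))

-- The witness is the largest power of p up to `N`; for prime p it is the contribution of p to
-- lcm(1, ..., N).
largest-power : ∀ {N p} → 1 ≤ N → 2 ≤ p → ∃[ w ] w ≤ N × 1 ≤ w × (∀ v → p ^ v ≤ N → p ^ v ∣ w)
largest-power {N} {p} 1≤N 2≤p = let e , p^e≤N , max = search N in
  p ^ e , p^e≤N , m^n>0 p e , λ v p^v≤N → m≤n⇒p^m∣p^n (max v (v≤N v p^v≤N) p^v≤N)
  where
  instance
    _ : NonZero p
    _ = >-nonZero (≤-trans (s≤s z≤n) 2≤p)
  -- As v < p^v, it is enough to search the exponents up to `N`.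
  n<p^n : ∀ n → n < p ^ n
  n<p^n zero    = s≤s z≤n
  n<p^n (suc n) = ≤-trans (s≤s (n<p^n n)) (m<n*m⁺ (p ^ n) (m^n>0 p n))
    where
    m<n*m⁺ : ∀ m → 0 < m → m < p * m
    m<n*m⁺ m 0<m = subst (m <_) (*-comm m p) (m<m*n m p {{>-nonZero 0<m}} 2≤p)
  v≤N : ∀ v → p ^ v ≤ N → v ≤ N
  v≤N v p^v≤N = <⇒≤ (<-≤-trans (n<p^n v) p^v≤N)
  m≤n⇒p^m∣p^n : ∀ {m n} → m ≤ n → p ^ m ∣ p ^ n
  m≤n⇒p^m∣p^n {m} {n} m≤n = divides (p ^ (n ∸ m))
    (trans (cong (p ^_) (sym (m∸n+n≡m m≤n))) (^-distribˡ-+-* p (n ∸ m) m))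
  search : ∀ k → ∃[ e ] p ^ e ≤ N × (∀ v → v ≤ k → p ^ v ≤ N → v ≤ e)
  search zero    = 0 , 1≤N , λ v v≤0 _ → v≤0
  search (suc k) with p ^ suc k ≤? N
  ... | yes p^k≤N = suc k , p^k≤N , λ v v≤k _ → v≤k
  ... | no  p^k≰N = let e , p^e≤N , max = search k in e , p^e≤N , λ v v≤1+k p^v≤N →
    max v (m<1+n⇒m≤n (≤∧≢⇒< v≤1+k λ { refl → p^k≰N p^v≤N })) p^v≤N

-- A product of largest powers, one for each entry of `xs`, replaces lcm(1, ..., N). Composite or
-- repeated entries only enlarge D, within the same bound, so any list of candidates will do.
common-multiple : ∀ {N} → 1 ≤ N → (xs : List ℕ) →
  ∃[ D ] D ≤ N ^ length xs × 1 ≤ D × (∀ {p} → Prime p → p ∈ xs → ∀ v → p ^ v ≤ N → p ^ v ∣ D)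
common-multiple 1≤N [] = 1 , ≤-refl , ≤-refl , λ _ ()
common-multiple {N} 1≤N (x ∷ xs) with common-multiple 1≤N xs | 2 ≤? x
... | D , D≤ , 1≤D , div | yes 2≤x =
  let w , w≤N , 1≤w , divʷ = largest-power 1≤N 2≤x in
  w * D , *-mono-≤ w≤N D≤ , *-mono-≤ 1≤w 1≤D , λ where
    isPrime (here refl) v p^v≤N → ∣-trans (divʷ v p^v≤N) (m∣m*n D)
    isPrime (there p∈xs) v p^v≤N → ∣-trans (div isPrime p∈xs v p^v≤N) (n∣m*n w)
-- The entries 0 and 1 are not prime and contribute the factor 1.
... | D , D≤ , 1≤D , div | no 2≰x = D , ≤-trans D≤ (m≤n*m _ N {{>-nonZero 1≤N}}) , 1≤D , λ where
    isPrime (here refl) → contradiction (nonTrivial⇒n>1 _ {{prime⇒nonTrivial isPrime}}) 2≰x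
    isPrime (there p∈xs) → div isPrime p∈xs

-- Nair's argument: `leibniz n n` is at least 4^n and divides every common multiple of 1, ..., 2n +
-- 1. The form with a list is later applied to a list of exceptions assumed to hold all primes.
chebyshev : ∀ n (xs : List ℕ) → (∀ {p} → Prime p → p ≤ suc (n + n) → p ∈ xs) →
            4 ^ n ≤ suc (n + n) ^ length xs
chebyshev n xs primes with common-multiple {suc (n + n)} (s≤s z≤n) xs
... | D , D≤ , 1≤D , div = begin
  4 ^ n                     ≤⟨ 4^n≤leibniz n ⟩
  leibniz n n               ≤⟨ ∣⇒≤ {{>-nonZero 1≤D}} (leibniz-∣ multiple n n ≤-refl) ⟩
  D                         ≤⟨ D≤ ⟩
  suc (n + n) ^ length xs   ∎
  where
  open ≤-Reasoning
  multiple : ∀ m → .{{NonZero m}} → m ≤ suc (n + n) → m ∣ D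
  multiple m m≤N = prime-powers-∣⇒∣ m λ where
    isPrime zero    _     → 1∣ D
    {p} isPrime (suc v) p^v∣m →
      let instance _ = prime⇒nonZero isPrime
          p^v≤N = ≤-trans (∣⇒≤ p^v∣m) m≤N
      in  div isPrime (primes isPrime (≤-trans (m≤m*n p (p ^ v) {{m^n≢0 p v}}) p^v≤N)) (suc v) p^v≤N

-- Decimal representations and blocks of digits.

-- Horner's scheme from the left, with `q` the number already written. At `q` = 0 it evaluates a
-- string, leading zeros allowed.
appendDigits : ℕ → Expansion 10 → ℕ
appendDigits q []       = q
appendDigits q (e ∷ es) = appendDigits (q * 10 + toℕ e) es

appendDigits-0 : ∀ q es → appendDigits q es ≡ q * 10 ^ length es + appendDigits 0 es
appendDigits-0 q []       = sym (trans (+-identityʳ (q * 1)) (*-identityʳ q))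
appendDigits-0 q (e ∷ es) = begin
  appendDigits (q * 10 + toℕ e) es                     ≡⟨ appendDigits-0 (q * 10 + toℕ e) es ⟩
  (q * 10 + toℕ e) * T + appendDigits 0 es             ≡⟨ move q (toℕ e) T (appendDigits 0 es) ⟩
  q * (10 * T) + (toℕ e * T + appendDigits 0 es)       ≡⟨ cong (λ m → q * (10 * T) + m) (appendDigits-0 (toℕ e) es) ⟨
  q * (10 * T) + appendDigits (toℕ e) es               ∎
  where
  open ≡-Reasoning
  T = 10 ^ length es
  move : ∀ q e T a → (q * 10 + e) * T + a ≡ q * (10 * T) + (e * T + a)
  move = solve-∀

q*m+r<p*m : ∀ {q p r m} → q < p → r < m → q * m + r < p * m
q*m+r<p*m {q} {p} {r} {m} q<p r<m = begin-strict
  q * m + r   <⟨ +-monoʳ-< (q * m) r<m ⟩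
  q * m + m   ≡⟨ +-comm (q * m) m ⟩
  suc q * m   ≤⟨ *-monoˡ-≤ m q<p ⟩
  p * m       ∎
  where open ≤-Reasoning

appendDigits-< : ∀ es → appendDigits 0 es < 10 ^ length es
appendDigits-< []       = s≤s z≤n
appendDigits-< (e ∷ es) = subst (_< 10 * 10 ^ length es) (sym (appendDigits-0 (toℕ e) es))
  (q*m+r<p*m (toℕ<n e) (appendDigits-< es))

representation-∷ʳ : ∀ {q ds} → IsDecimalRepresentation q ds → ∀ e →
                    IsDecimalRepresentation (q * 10 + toℕ e) (ds ++ [ e ])
representation-∷ʳ {q} (decimal {d} {ds} d≢0 eq) e = decimal d≢0 (begin
  fromDigits (reverse ((d ∷ ds) ++ [ e ]))          ≡⟨ cong fromDigits (reverse-++ (d ∷ ds) [ e ]) ⟩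
  toℕ e + fromDigits (reverse (d ∷ ds)) * 10        ≡⟨ cong (λ n → toℕ e + n * 10) eq ⟩
  toℕ e + q * 10                                    ≡⟨ +-comm (toℕ e) (q * 10) ⟩
  q * 10 + toℕ e                                    ∎)
  where open ≡-Reasoning

representation-++ : ∀ {q ds} → IsDecimalRepresentation q ds → ∀ es →
                    IsDecimalRepresentation (appendDigits q es) (ds ++ es)
representation-++ {q} {ds@(_ ∷ _)} rep [] = subst (IsDecimalRepresentation q) (sym (++-identityʳ ds)) rep
representation-++ {q} {ds} rep (e ∷ es) = subst (IsDecimalRepresentation _)
  (++-assoc ds [ e ] es) (representation-++ (representation-∷ʳ rep e) es)

n≡q*10+e : ∀ n → n ≡ n /ℕ 10 * 10 + toℕ (n mod 10)
n≡q*10+e n = trans (m≡m%n+[m/n]*n n 10) (trans (+-comm (n % 10) (n /ℕ 10 * 10))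
  (cong (λ m → n /ℕ 10 * 10 + m) (sym (toℕ-fromℕ< (m%n<n n 10)))))

representation : ∀ n → 0 < n → ∃[ ds ] IsDecimalRepresentation n ds
representation = <-rec (λ n → 0 < n → ∃[ ds ] IsDecimalRepresentation n ds) rep
  where
  rep : ∀ n → (∀ {m} → m < n → 0 < m → ∃[ ds ] IsDecimalRepresentation m ds) →
        0 < n → ∃[ ds ] IsDecimalRepresentation n ds
  rep n rec 0<n with n <? 10
  ... | yes n<10 = [ d ] , decimal d≢0 (trans (+-identityʳ (toℕ d)) d≡n)
    where
    d = fromℕ< n<10
    d≡n : toℕ d ≡ n
    d≡n = toℕ-fromℕ< n<10
    d≢0 : d ≢ Fin.zero
    d≢0 d≡0 = <-irrefl (trans (sym (cong toℕ d≡0)) d≡n) 0<n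
  ... | no n≮10 =
    let ds , rep-n/10 = rec (m/n<m n 10 {{>-nonZero 0<n}} (s≤s (s≤s z≤n))) (m≥n⇒m/n>0 (≮⇒≥ n≮10))
    in  ds ++ [ n mod 10 ] , subst (λ m → IsDecimalRepresentation m (ds ++ [ n mod 10 ]))
          (sym (n≡q*10+e n)) (representation-∷ʳ rep-n/10 (n mod 10))

value : ∀ {l} → Vec Decimal l → ℕ
value S = appendDigits 0 (toList S)

value-< : ∀ {l} (S : Vec Decimal l) → value S < 10 ^ l
value-< {l} S = subst (λ k → value S < 10 ^ k) (length-toList S) (appendDigits-< (toList S))

-- A positive `q` supplies a nonzero leading digit, so that any leading zeros of `S` are really
-- written.
contains-suffix : ∀ {l} (S : Vec Decimal l) q → 0 < q → (q * 10 ^ l + value S) Contains S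
contains-suffix {l} S q 0<q =
  let ds , rep = representation q 0<q
      eq = trans (appendDigits-0 q (toList S)) (cong (λ k → q * 10 ^ k + value S) (length-toList S))
  in  ds ++ toList S
    , subst (λ n → IsDecimalRepresentation n (ds ++ toList S)) eq (representation-++ rep (toList S))
    , ds Infix.++ⁱ Infix.fromPointwise (Pointwise.refl refl)

-- Induction on `k` appends the k digits of `r`, leading zeros included: first those of r / 10, then
-- r mod 10.
contains-prefix : ∀ {l} {S : Vec Decimal l} k {q r} → r < 10 ^ k → q Contains S → (q * 10 ^ k + r) Contains S
contains-prefix {S = S} zero    {q} {zero}  _  q∋S =
  subst (_Contains S) (sym (trans (+-identityʳ (q * 1)) (*-identityʳ q))) q∋S
contains-prefix {S = S} zero    {q} {suc r} (s≤s ()) q∋S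
contains-prefix {S = S} (suc k) {q} {r} r<  q∋S
  with contains-prefix k (m<n*o⇒m/o<n (subst (r <_) (*-comm 10 (10 ^ k)) r<)) q∋S
... | ds , rep , inf = ds ++ [ r mod 10 ]
  , subst (λ n → IsDecimalRepresentation n (ds ++ [ r mod 10 ])) eq (representation-∷ʳ rep (r mod 10))
  , inf Infix.ⁱ++ [ r mod 10 ]
  where
  move : ∀ q T u e → (q * T + u) * 10 + e ≡ q * (10 * T) + (u * 10 + e)
  move = solve-∀
  eq : (q * 10 ^ k + r /ℕ 10) * 10 + toℕ (r mod 10) ≡ q * (10 * 10 ^ k) + r
  eq = trans (move q (10 ^ k) (r /ℕ 10) (toℕ (r mod 10)))
    (cong (λ m → q * (10 * 10 ^ k) + m) (sym (n≡q*10+e r)))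

-- Counting the numbers without a given digit.

length-cartesianProductWith : ∀ {a b c} {A : Set a} {B : Set b} {C : Set c} (f : A → B → C) xs ys →
                              length (cartesianProductWith f xs ys) ≡ length xs * length ys
length-cartesianProductWith f []       ys = refl
length-cartesianProductWith f (x ∷ xs) ys = trans (length-++ (map (f x) ys))
  (cong₂ _+_ (length-map (f x) ys) (length-cartesianProductWith f xs ys))

-- Here `s` is the forbidden digit and `c` the number of digits above it, so the number of permitted
-- digits is `s + c`, free of subtraction.
module Avoiding (s c : ℕ) where

  base : ℕ
  base = suc (s + c)

  otherDigits : List ℕ
  otherDigits = upTo s ++ applyUpTo (λ i → suc (s + i)) c

  -- The numbers below base ^ t whose expansion has no digit s, except
  -- possibly as leading digit.
  avoiding : ℕ → List ℕ
  avoiding zero    = [ 0 ]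
  avoiding (suc t) = s ∷ cartesianProductWith (λ q r → q * base + r) (avoiding t) otherDigits

  ∈-otherDigits : ∀ {r} → r < base → r ≢ s → r ∈ otherDigits
  ∈-otherDigits {r} r<B r≢s with <-cmp r s
  ... | tri< r<s _ _ = ∈-++⁺ˡ (∈-upTo⁺ r<s)
  ... | tri≈ _ r≡s _ = contradiction r≡s r≢s
  ... | tri> _ _ s<r = ∈-++⁺ʳ (upTo s)
    (subst (_∈ applyUpTo (λ i → suc (s + i)) c) (m+[n∸m]≡n s<r)
      (∈-applyUpTo⁺ (λ i → suc (s + i))
        (+-cancelˡ-< (suc s) _ _ (subst (_< base) (sym (m+[n∸m]≡n s<r)) r<B))))

  length-otherDigits : length otherDigits ≡ s + c
  length-otherDigits = trans (length-++ (upTo s))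
    (cong₂ _+_ (length-upTo s) (length-applyUpTo (λ i → suc (s + i)) c))

  length-avoiding : ∀ t → length (avoiding (suc t)) ≡ suc (length (avoiding t) * (s + c))
  length-avoiding t = cong suc (trans
    (length-cartesianProductWith _ (avoiding t) otherDigits)
    (cong (length (avoiding t) *_) length-otherDigits))

  -- The length is 1 + W + ... + W^t with W = s + c.
  length-avoiding-≤ : 9 ≤ s + c → ∀ t → suc (8 * length (avoiding t)) ≤ 9 * (s + c) ^ t
  length-avoiding-≤ 9≤W zero    = ≤-refl
  length-avoiding-≤ 9≤W (suc t) = begin
    suc (8 * length (avoiding (suc t)))  ≡⟨ cong (λ n → suc (8 * n)) (length-avoiding t) ⟩
    suc (8 * suc (h * W))                ≡⟨ expand h W ⟩
    9 + 8 * h * W                        ≤⟨ +-monoˡ-≤ (8 * h * W) 9≤W ⟩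
    suc (8 * h) * W                      ≤⟨ *-monoˡ-≤ W (length-avoiding-≤ 9≤W t) ⟩
    9 * W ^ t * W                        ≡⟨ rotate W (W ^ t) ⟩
    9 * (W * W ^ t)                      ∎
    where
    open ≤-Reasoning
    W = s + c
    h = length (avoiding t)
    expand : ∀ h W → suc (8 * suc (h * W)) ≡ 9 + 8 * h * W
    expand = solve-∀
    rotate : ∀ W w → 9 * w * W ≡ 9 * (W * w)
    rotate = solve-∀

  -- Recursion on the last digit in this base. `P` stands for containing S: it survives further
  -- digits and holds once `s` follows a positive number.
  avoiding-or : (P : ℕ → Set) →
                (∀ {q r} → r < base → P q → P (q * base + r)) →
                (∀ q → 0 < q → P (q * base + s)) →
                ∀ t n → n < base ^ t → n ∈ avoiding t ⊎ P n
  avoiding-or P prefix suffix zero    zero    _ = inj₁ (here refl)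
  avoiding-or P prefix suffix zero    (suc n) (s≤s ())
  avoiding-or P prefix suffix (suc t) n n<
    with n /ℕ base | n % base | m≡m%n+[m/n]*n n base | m%n<n n base
       | m<n*o⇒m/o<n {n} {base ^ t} {base} (subst (n <_) (*-comm base (base ^ t)) n<)
  ... | q | r | n≡ | r<B | q< with r ≟ s | q | avoiding-or P prefix suffix t q q<
  -- With quotient 0 the digit `s` is the leading one, on which `suffix` is silent; the number is
  -- then the head of the list.
  ... | yes refl | zero  | _       = inj₁ (here (trans n≡ (+-identityʳ r)))
  ... | yes refl | suc u | _       =
    inj₂ (subst P (sym (trans n≡ (+-comm r (suc u * base)))) (suffix (suc u) (s≤s z≤n)))
  ... | no r≢s   | u     | inj₁ u∈ =
    inj₁ (there (subst (_∈ _) (sym (trans n≡ (+-comm r (u * base))))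
      (∈-cartesianProductWith⁺ (λ q r → q * base + r) u∈ (∈-otherDigits r<B r≢s))))
  ... | no r≢s   | u     | inj₂ Pu =
    inj₂ (subst P (sym (trans n≡ (+-comm r (u * base)))) (prefix r<B Pu))

-- Bounded search and exponential inequalities.

-- This makes the counting argument constructive: either the search finds a witness, or the
-- alternative holds throughout and can be refuted.
bounded-search : ∀ {A B : ℕ → Set} N → (∀ n → n < N → A n ⊎ B n) →
                 (∃[ n ] n < N × A n) ⊎ (∀ n → n < N → B n)
bounded-search zero    _ = inj₂ λ _ ()
bounded-search {A} {B} (suc N) A∨B with A∨B N ≤-refl | bounded-search N (λ n n<N → A∨B n (m≤n⇒m≤1+n n<N))
... | inj₁ AN | _                   = inj₁ (N , ≤-refl , AN)
... | inj₂ _  | inj₁ (n , n<N , An) = inj₁ (n , m≤n⇒m≤1+n n<N , An)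
... | inj₂ BN | inj₂ B<N            = inj₂ λ n n<1+N → extend n (m≤n⇒m<n∨m≡n (m<1+n⇒m≤n n<1+N))
  where
  extend : ∀ n → n < N ⊎ n ≡ N → B n
  extend n (inj₁ n<N)  = B<N n n<N
  extend n (inj₂ refl) = BN

-- The first two terms of the binomial expansion.
W^n+nW^[n-1]≤[1+W]^n : ∀ W n → W ^ suc n + suc n * W ^ n ≤ suc W ^ suc n
W^n+nW^[n-1]≤[1+W]^n W zero    = ≤-reflexive (base W)
  where
  base : ∀ W → W * 1 + 1 ≡ suc W * 1
  base = solve-∀
W^n+nW^[n-1]≤[1+W]^n W (suc n) = begin
  W * (W * w) + suc (suc n) * (W * w)               ≤⟨ m≤m+n _ (suc n * w) ⟩
  W * (W * w) + suc (suc n) * (W * w) + suc n * w   ≡⟨ expand W w n ⟩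
  suc W * (W * w + suc n * w)                       ≤⟨ *-monoʳ-≤ (suc W) (W^n+nW^[n-1]≤[1+W]^n W n) ⟩
  suc W * suc W ^ suc n                             ∎
  where
  open ≤-Reasoning
  w = W ^ n
  expand : ∀ W w n → W * (W * w) + suc (suc n) * (W * w) + suc n * w ≡ suc W * (W * w + suc n * w)
  expand = solve-∀

-- With B = W + 1 this is (1 - 1/B)^B ≤ 1/2: each of the first two binomial terms of B^B is at least
-- W^B.
2W^[1+W]≤[1+W]^[1+W] : ∀ W → 2 * W ^ suc W ≤ suc W ^ suc W
2W^[1+W]≤[1+W]^[1+W] W = begin
  2 * W ^ suc W                  ≡⟨ cong (λ m → W ^ suc W + m) (+-identityʳ (W ^ suc W)) ⟩
  W ^ suc W + W * W ^ W          ≤⟨ +-monoʳ-≤ (W ^ suc W) (*-monoˡ-≤ (W ^ W) (n≤1+n W)) ⟩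
  W ^ suc W + suc W * W ^ W      ≤⟨ W^n+nW^[n-1]≤[1+W]^n W W ⟩
  suc W ^ suc W                  ∎
  where open ≤-Reasoning

^-distribʳ-* : ∀ m n o → (m * n) ^ o ≡ m ^ o * n ^ o
^-distribʳ-* m n zero    = refl
^-distribʳ-* m n (suc o) = trans (cong (m * n *_) (^-distribʳ-* m n o)) (swap m n (m ^ o) (n ^ o))
  where
  swap : ∀ m n p q → m * n * (p * q) ≡ m * p * (n * q)
  swap = solve-∀

2^k*W^t≤[1+W]^t : ∀ W k → 2 ^ k * W ^ (suc W * k) ≤ suc W ^ (suc W * k)
2^k*W^t≤[1+W]^t W k = begin
  2 ^ k * W ^ (suc W * k)       ≡⟨ cong (2 ^ k *_) (^-*-assoc W (suc W) k) ⟨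
  2 ^ k * (W ^ suc W) ^ k       ≡⟨ ^-distribʳ-* 2 (W ^ suc W) k ⟨
  (2 * W ^ suc W) ^ k           ≤⟨ ^-monoˡ-≤ k (2W^[1+W]≤[1+W]^[1+W] W) ⟩
  (suc W ^ suc W) ^ k           ≡⟨ ^-*-assoc (suc W) (suc W) k ⟩
  suc W ^ (suc W * k)           ∎
  where open ≤-Reasoning

-- As (l + 1)^2 ≤ 4 l^2 for l ≥ 1, a step multiplies the main term by at most 40, against 1024 on
-- the right.
80l²10^l<1024^l : ∀ l → 1 ≤ l → 3 + 80 * (l * l * 10 ^ l) ≤ 1024 ^ l
80l²10^l<1024^l 1 _ = ≤ᵇ⇒≤ 803 1024 _
80l²10^l<1024^l (suc l@(suc k)) _ = begin
  3 + 80 * (suc l * suc l * (10 * T))            ≤⟨ +-monoʳ-≤ 3 (*-monoʳ-≤ 80 (*-monoˡ-≤ (10 * T) square)) ⟩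
  3 + 80 * (4 * (l * l) * (10 * T))              ≤⟨ m≤m+n _ (3069 + 78720 * (l * l * T)) ⟩
  3 + 80 * (4 * (l * l) * (10 * T)) + (3069 + 78720 * (l * l * T))  ≡⟨ collect (l * l) T ⟩
  1024 * (3 + 80 * (l * l * T))                  ≤⟨ *-monoʳ-≤ 1024 (80l²10^l<1024^l l (s≤s z≤n)) ⟩
  1024 * 1024 ^ l                                ∎
  where
  open ≤-Reasoning
  T = 10 ^ l
  expand : ∀ k → 4 * (suc k * suc k) ≡ suc (suc k) * suc (suc k) + (3 * (k * k) + 4 * k)
  expand = solve-∀
  square : suc l * suc l ≤ 4 * (l * l)
  square = subst (suc l * suc l ≤_) (sym (expand k)) (m≤m+n _ _)
  collect : ∀ a T → 3 + 80 * (4 * a * (10 * T)) + (3069 + 78720 * (a * T)) ≡ 1024 * (3 + 80 * (a * T))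
  collect = solve-∀

^-cancelˡ-≤ : ∀ m {n o} → 1 < m → m ^ n ≤ m ^ o → n ≤ o
^-cancelˡ-≤ m 1<m le = ≮⇒≥ λ o<n → <⇒≱ (^-monoʳ-< m 1<m o<n) le

10^k≤2^4k : ∀ k → 10 ^ k ≤ 2 ^ (4 * k)
10^k≤2^4k k = subst (10 ^ k ≤_) (^-*-assoc 2 4 k) (^-monoˡ-≤ k (≤ᵇ⇒≤ 10 16 _))

-- Primes against exceptions.

-- Logarithms to base 2 in `chebyshev`, with the logarithm of 10 rounded up to 4.
chebyshev-10^k : ∀ k (xs : List ℕ) → (∀ {p} → Prime p → p < 10 ^ k → p ∈ xs) →
                 10 ^ k ≤ 2 + 4 * k * length xs
chebyshev-10^k zero    xs _      = m≤m+n 1 _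
chebyshev-10^k k@(suc j) xs primes = begin
  10 ^ k                       ≡⟨ 10^k≡ ⟩
  2 + 2 * n                    ≤⟨ +-monoʳ-≤ 2 (^-cancelˡ-≤ 2 ≤-refl power-≤) ⟩
  2 + 4 * k * length xs        ∎
  where
  open ≤-Reasoning
  -- Thus 2n + 1 = 10^k - 1, the largest number below 10^k.
  n = pred (5 * 10 ^ j)
  5*10^j≢0 : NonZero (5 * 10 ^ j)
  5*10^j≢0 = m*n≢0 5 (10 ^ j) {{_}} {{m^n≢0 10 j}}
  10^k≡ : 10 ^ k ≡ 2 + 2 * n
  10^k≡ = begin-equality
    10 * 10 ^ j               ≡⟨ *-assoc 2 5 (10 ^ j) ⟩
    2 * (5 * 10 ^ j)          ≡⟨ cong (2 *_) (suc-pred (5 * 10 ^ j) {{5*10^j≢0}}) ⟨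
    2 * suc n                 ≡⟨ *-suc 2 n ⟩
    2 + 2 * n                 ∎
  10^k≡′ : 10 ^ k ≡ suc (suc (n + n))
  10^k≡′ = trans 10^k≡ (cong (λ m → suc (suc (n + m))) (+-identityʳ n))
  primes′ : ∀ {p} → Prime p → p ≤ suc (n + n) → p ∈ xs
  primes′ {p} isPrime p≤ = primes isPrime (subst (p <_) (sym 10^k≡′) (s≤s p≤))
  power-≤ : 2 ^ (2 * n) ≤ 2 ^ (4 * k * length xs)
  power-≤ = begin
    2 ^ (2 * n)                       ≡⟨ ^-*-assoc 2 2 n ⟨
    4 ^ n                             ≤⟨ chebyshev n xs primes′ ⟩
    suc (n + n) ^ length xs           ≤⟨ ^-monoˡ-≤ (length xs) (≤-trans (n≤1+n _) (≤-reflexive (sym 10^k≡′))) ⟩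
    (10 ^ k) ^ length xs              ≤⟨ ^-monoˡ-≤ (length xs) (10^k≤2^4k k) ⟩
    (2 ^ (4 * k)) ^ length xs         ≡⟨ ^-*-assoc 2 (4 * k) (length xs) ⟩
    2 ^ (4 * k * length xs)           ∎

module _ {l s c : ℕ} (1≤l : 1 ≤ l) (base≡ : suc (s + c) ≡ 10 ^ l) where

  open Avoiding s c

  private
    W t : ℕ
    W = s + c
    -- In `2^k*W^t≤[1+W]^t` this is k = 10 l, so the gain 2^k is 1024^l. These `t` digits are l t
    -- decimal digits.
    t = base * (10 * l)

    9≤W : 9 ≤ W
    9≤W = s≤s⁻¹ (subst (10 ≤_) (sym base≡) (^-monoʳ-≤ 10 1≤l))

    instance
      W≢0 : NonZero W
      W≢0 = >-nonZero (≤-trans (s≤s z≤n) 9≤W)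

    98≤t : 98 ≤ t
    98≤t = ≤-trans (m≤m+n 98 2) (*-mono-≤ (s≤s 9≤W) (*-monoʳ-≤ 10 1≤l))

    -- The discarded numbers account for at most 7/8 of W^t, the avoiding ones for at most 9/8.
    length-≤ : ∀ M → M ≤ 8 ^ 97 → length (upTo M ++ avoiding t) ≤ 2 * W ^ t
    length-≤ M M≤ = *-cancelˡ-≤ 8 (begin
      8 * length (upTo M ++ avoiding t)       ≡⟨ cong (8 *_) (trans (length-++ (upTo M)) (cong (_+ h) (length-upTo M))) ⟩
      8 * (M + h)                             ≡⟨ *-distribˡ-+ 8 M h ⟩
      8 * M + 8 * h                           ≤⟨ +-mono-≤ 8M≤ (≤-trans (n≤1+n _) (length-avoiding-≤ 9≤W t)) ⟩
      7 * W ^ t + 9 * W ^ t                   ≡⟨ collect (W ^ t) ⟩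
      8 * (2 * W ^ t)                         ∎)
      where
      open ≤-Reasoning
      h = length (avoiding t)
      collect : ∀ w → 7 * w + 9 * w ≡ 8 * (2 * w)
      collect = solve-∀
      8M≤ : 8 * M ≤ 7 * W ^ t
      8M≤ = begin
        8 * M          ≤⟨ *-monoʳ-≤ 8 M≤ ⟩
        -- The threshold is a power of 8 so that 8 ≤ `W` and 98 ≤ `t` compare it with W^t.
        8 ^ 98         ≤⟨ ^-monoˡ-≤ 98 (≤-trans (n≤1+n 8) 9≤W) ⟩
        W ^ 98         ≤⟨ ^-monoʳ-≤ W 98≤t ⟩
        W ^ t          ≤⟨ m≤n*m (W ^ t) 7 ⟩
        7 * W ^ t      ∎

    base^t≡ : base ^ t ≡ 10 ^ (l * t)
    base^t≡ = trans (cong (_^ t) base≡) (^-*-assoc 10 l t)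

    -- Since t = 10 l B, the coefficient 4 l t * 2 equals 80 l^2 B, which even with 3 added is at
    -- most 1024^l; and 1024^l W^t ≤ B^t.
    too-long : ∀ {n} → n ≤ 2 * W ^ t → 2 + 4 * (l * t) * n < 10 ^ (l * t)
    too-long {n} n≤ = begin
      3 + 4 * (l * t) * n                          ≤⟨ +-monoʳ-≤ 3 (*-monoʳ-≤ (4 * (l * t)) n≤) ⟩
      3 + 4 * (l * t) * (2 * w)                    ≡⟨ cong (λ m → 3 + m) (collect l base w) ⟩
      3 + 80 * (l * l * base) * w                  ≤⟨ +-monoˡ-≤ _ (m≤m*n 3 w {{m^n≢0 W t}}) ⟩
      3 * w + 80 * (l * l * base) * w              ≡⟨ *-distribʳ-+ w 3 (80 * (l * l * base)) ⟨
      (3 + 80 * (l * l * base)) * w                ≡⟨ cong (λ B → (3 + 80 * (l * l * B)) * w) base≡ ⟩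
      (3 + 80 * (l * l * 10 ^ l)) * w              ≤⟨ *-monoˡ-≤ w (80l²10^l<1024^l l 1≤l) ⟩
      1024 ^ l * w                                 ≡⟨ cong (_* w) (^-*-assoc 2 10 l) ⟩
      2 ^ (10 * l) * w                             ≤⟨ 2^k*W^t≤[1+W]^t W (10 * l) ⟩
      base ^ t                                     ≡⟨ base^t≡ ⟩
      10 ^ (l * t)                                 ∎
      where
      open ≤-Reasoning
      w = W ^ t
      collect : ∀ l B w → 4 * (l * (B * (10 * l))) * (2 * w) ≡ 80 * (l * l * B) * w
      collect = solve-∀

  -- If the search failed, `upTo M ++ avoiding t` would hold every prime below 10^(l t), yet it is
  -- shorter than Chebyshev's bound allows.
  ∃-prime : (P : ℕ → Set) →
            (∀ {q r} → r < base → P q → P (q * base + r)) →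
            (∀ q → 0 < q → P (q * base + s)) →
            ∀ M → M ≤ 8 ^ 97 →
            ∃[ p ] Prime p × P p × M ≤ p × p < 10 ^ (l * t)
  ∃-prime P prefix suffix M M≤ with bounded-search (10 ^ (l * t)) classify
    where
    classify : ∀ n → n < 10 ^ (l * t) → (Prime n × P n × M ≤ n) ⊎ (Prime n → n ∈ upTo M ++ avoiding t)
    classify n n< with n <? M | prime? n | avoiding-or P prefix suffix t n (subst (n <_) (sym base^t≡) n<)
    ... | yes n<M | _           | _       = inj₂ λ _ → ∈-++⁺ˡ (∈-upTo⁺ n<M)
    ... | no n≮M  | no ¬prime   | _       = inj₂ λ isPrime → contradiction isPrime ¬prime
    ... | no n≮M  | yes isPrime | inj₁ n∈ = inj₂ λ _ → ∈-++⁺ʳ (upTo M) n∈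
    ... | no n≮M  | yes isPrime | inj₂ Pn = inj₁ (isPrime , Pn , ≮⇒≥ n≮M)
  ... | inj₁ (p , p< , isPrime , Pp , M≤p) = p , isPrime , Pp , M≤p , p<
  ... | inj₂ primes = contradiction
    (chebyshev-10^k (l * t) (upTo M ++ avoiding t) (λ {p} isPrime p< → primes p p< isPrime))
    (<⇒≱ (too-long (length-≤ M M≤)))

-- Rational bounds for logarithms and quotients.

^ℚ-1 : ∀ n → 1ℚ ^ℚ n ≡ 1ℚ
^ℚ-1 zero    = refl
^ℚ-1 (suc n) = trans (ℚ.*-identityˡ (1ℚ ^ℚ n)) (^ℚ-1 n)

ι-^ : ∀ m n → ι (m ^ n) ≡ ι m ^ℚ n
ι-^ m zero    = refl
ι-^ m (suc n) = trans (ι-* m (m ^ n)) (cong (λ (z : ℚ) → ι m *ℚ z) (ι-^ m n))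

ι-mono-< : ∀ {m n} → m < n → ι m <ℚ ι n
ι-mono-< {m} {n} m<n = subst (ι m <ℚ_)
  (trans (sym (ι-+ m (suc (n ∸ suc m)))) (cong ι (trans (+-suc m (n ∸ suc m)) (m+[n∸m]≡n m<n))))
  (p<p+q (0<ι (n ∸ suc m)))

-- Taking d m factors turns the compound approximation of e^(m c d) into the power (1 + c)^(d m) of
-- a fixed rational.
factor-multiple : ∀ m c d n → suc n ≡ d * m → factor (ι m *ℚ (c *ℚ ι d)) n ≡ 1ℚ +ℚ c
factor-multiple m c d n eq = cong (λ (z : ℚ) → 1ℚ +ℚ z) (begin
  ι m *ℚ (c *ℚ ι d) *ℚ i    ≡⟨ solve 4 (λ m c d i → m :* (c :* d) :* i := c :* ((d :* m) :* i)) refl (ι m) c (ι d) i ⟩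
  c *ℚ ((ι d *ℚ ι m) *ℚ i)  ≡⟨ cong (λ (z : ℚ) → c *ℚ (z *ℚ i)) (trans (cong ι eq) (ι-* d m)) ⟨
  c *ℚ (ι (suc n) *ℚ i)     ≡⟨ cong (λ (z : ℚ) → c *ℚ z) (ι-*-1/ n) ⟩
  c *ℚ 1ℚ                   ≡⟨ ℚ.*-identityʳ c ⟩
  c                         ∎)
  where
  open ≡-Reasoning
  open +-*-Solver using (solve; _:*_; _:=_)
  i = + 1 / suc n

-- Since 15/6 = 5/2, this power is at most e^(5/2), whence log 10 ≤ 5/2.
10≤[7/6]^15 : ι 10 ≤ℚ (+ 7 / 6) ^ℚ 15
10≤[7/6]^15 = toWitness {a? = ι 10 ℚ.≤? (+ 7 / 6) ^ℚ 15} _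

log-U : ∀ {p} (0<p : 0ℝ <ℝ fromℕ p) k → 0 < k → p < 10 ^ k →
        ∀ {q} → ι k *ℚ (+ 5 / 2) <ℚ q → U (log (fromℕ p) 0<p) q
log-U 0<p k@(suc j) _ p<10^k {q} b<q =
  ι k *ℚ (+ 5 / 2) , b<q , ι (10 ^ k) , ι-mono-< p<10^k , n
  , subst (0ℚ <ℚ_) (sym f≡) (ℚ.positive⁻¹ (+ 7 / 6)) , (begin
    ι (10 ^ k)                     ≡⟨ ι-^ 10 k ⟩
    ι 10 ^ℚ k                      ≤⟨ ^-mono k (0≤ι 10) 10≤[7/6]^15 ⟩
    ((+ 7 / 6) ^ℚ 15) ^ℚ k         ≡⟨ ^-assocʳ (+ 7 / 6) 15 k ⟩
    (+ 7 / 6) ^ℚ (15 * k)          ≡⟨ cong (_^ℚ (15 * k)) f≡ ⟨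
    compound (ι k *ℚ (+ 5 / 2)) n  ∎)
  where
  open ℚ.≤-Reasoning
  -- `suc n` is 15 k, so 5k/2 is spread over 15 k factors 1 + 1/6.
  n = j + 14 * k
  f≡ : factor (ι k *ℚ (+ 5 / 2)) n ≡ + 7 / 6
  f≡ = factor-multiple k (+ 1 / 6) 15 n refl

-- From e^(1/2) ≤ (1 - 1/2)^-1 = 2, raised to the power `m`.
log-L : ∀ {p} (0<p : 0ℝ <ℝ fromℕ p) m → 0 < m → 2 ^ m < p →
        ∀ {q} → q <ℚ ι m *ℚ ½ → L (log (fromℕ p) 0<p) q
log-L 0<p m@(suc j) _ 2^m<p {q} q<a =
  ι m *ℚ ½ , q<a , ι (2 ^ m) , ι-mono-< 2^m<p , j
  , subst (0ℚ <ℚ_) (sym f≡) (ℚ.positive⁻¹ ½) , ℚ.≤-reflexive (sym (begin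
    ι (2 ^ m) *ℚ compound (-ℚ (ι m *ℚ ½)) j  ≡⟨ cong₂ (λ (y z : ℚ) → y *ℚ z ^ℚ m) (ι-^ 2 m) f≡ ⟩
    ι 2 ^ℚ m *ℚ ½ ^ℚ m                       ≡⟨ ^-distrib-* (ι 2) ½ m ⟨
    1ℚ ^ℚ m                                  ≡⟨ ^ℚ-1 m ⟩
    1ℚ                                       ∎))
  where
  open ≡-Reasoning
  open +-*-Solver using (solve; _:*_; _:=_; con) renaming (:-_ to :neg_)
  f≡ : factor (-ℚ (ι m *ℚ ½)) j ≡ ½
  f≡ = trans (cong (λ q → factor q j) (solve 1 (λ m → :neg (m :* con ½) := m :* (con (-ℚ ½) :* con (ι 1))) refl (ι m)))
    (factor-multiple m (-ℚ ½) 1 j (sym (*-identityˡ m)))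

-- This gives e^(22/5) ≤ (1 - 1/5)^-22 ≤ 144, with 22 factors.
1≤144*[4/5]^22 : 1ℚ ≤ℚ ι 144 *ℚ (+ 4 / 5) ^ℚ 22
1≤144*[4/5]^22 = toWitness {a? = 1ℚ ℚ.≤? ι 144 *ℚ (+ 4 / 5) ^ℚ 22} _

log-144-L : ∀ x (0<x : 0ℝ <ℝ x) → L x (ι 144) → ∀ {q} → q <ℚ + 22 / 5 → L (log x 0<x) q
log-144-L x 0<x L144 q< = + 22 / 5 , q< , ι 144 , L144 , 21
  , ℚ.positive⁻¹ (+ 4 / 5) , 1≤144*[4/5]^22

-- A lower bound r of the quotient has r d ≤ a < x for some d > y. If K < r, then K z ≤ K d ≤ r d ≤
-- a < K z.
÷-≤ : ∀ {x y} (0<y : 0ℝ <ℝ y) {z K} → 0ℚ ≤ℚ K → L y z → U x (K *ℚ z) →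
      x ÷ℝ y [ inj₂ 0<y ] ≤ℝ fromℚ K
÷-≤ {x} {y} 0<y {z} {K} 0≤K Lz UKz {q} (r , q<r , a , c , d , La , 0<c , Lc , Ud , _ , rd≤a) =
  ℚ.<-≤-trans q<r (ℚ.≮⇒≥ λ K<r → ℚ.<-irrefl refl (begin-strict
    K *ℚ z  ≤⟨ *-monoˡ 0≤K (ℚ.<⇒≤ (L<U y Lz Ud)) ⟩
    K *ℚ d  ≤⟨ *-monoʳ (ℚ.<⇒≤ (ℚ.<-trans 0<c (L<U y Lc Ud))) (ℚ.<⇒≤ K<r) ⟩
    r *ℚ d  ≤⟨ rd≤a ⟩
    a       <⟨ L<U x La UKz ⟩
    K *ℚ z  ∎))
  where open ℚ.≤-Reasoning

-- The prime and its size.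

-- The string `S` is a single digit in base 10^l, namely `value S`; the exponent l t becomes 10 l^2
-- 10^l.
∃-prime-containing : ∀ {l} → 1 ≤ l → (S : Vec Decimal l) →
  ∃[ p ] Prime p × p Contains S × 8 ^ 97 ≤ p × p < 10 ^ (10 * (l ^ 2 * 10 ^ l))
∃-prime-containing {l} 1≤l S =
  let p , isPrime , p∋S , M≤p , p< =
        ∃-prime {l} {value S} {c} 1≤l base≡ (_Contains S) prefix suffix (8 ^ 97) ≤-refl
  in  p , isPrime , p∋S , M≤p , subst (λ k → p < 10 ^ k) exponent≡ p<
  where
  c = 10 ^ l ∸ suc (value S)
  base≡ : suc (value S + c) ≡ 10 ^ l
  base≡ = m+[n∸m]≡n (value-< S)
  prefix : ∀ {q r} → r < suc (value S + c) → q Contains S → (q * suc (value S + c) + r) Contains S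
  prefix {q} {r} r<B q∋S = subst (λ B → (q * B + r) Contains S) (sym base≡)
    (contains-prefix l (subst (r <_) base≡ r<B) q∋S)
  suffix : ∀ q → 0 < q → (q * suc (value S + c) + value S) Contains S
  suffix q 0<q = subst (λ B → (q * B + value S) Contains S) (sym base≡) (contains-suffix S q 0<q)
  rearrange : ∀ l B → l * (B * (10 * l)) ≡ 10 * (l * (l * 1) * B)
  rearrange = solve-∀
  exponent≡ : l * (suc (value S + c) * (10 * l)) ≡ 10 * (l ^ 2 * 10 ^ l)
  exponent≡ = trans (cong (λ B → l * (B * (10 * l))) base≡) (rearrange l (10 ^ l))

25n<5·7n·4·39 : ∀ n → 0 < n → ι (10 * n) *ℚ (+ 5 / 2) <ℚ (+ 57 / 10) *ℚ ι n *ℚ (+ 439 / 100)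
25n<5·7n·4·39 n 0<n = subst₂ _<ℚ_
  (trans (solve 1 (λ x → x :* con (+ 25 / 1) := con (ι 10) :* x :* con (+ 5 / 2)) refl (ι n))
    (cong (λ (z : ℚ) → z *ℚ (+ 5 / 2)) (sym (ι-* 10 n))))
  (solve 1 (λ x → x :* con (+ 25023 / 1000) := con (+ 57 / 10) :* x :* con (+ 439 / 100)) refl (ι n))
  (*-strictˡ (ι-mono-< 0<n) (toWitness {a? = + 25 / 1 ℚ.<? + 25023 / 1000} _))
  where open +-*-Solver using (solve; _:*_; _:=_; con)

log/loglog-≤ : ∀ {p n} → 0 < n → 8 ^ 97 ≤ p → p < 10 ^ (10 * n) →
  Σ[ 0<p ∈ 0ℝ <ℝ fromℕ p ]
  Σ[ 0<logp ∈ 0ℝ <ℝ log (fromℕ p) 0<p ]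
  Σ[ loglogp#0 ∈ log (log (fromℕ p) 0<p) 0<logp #ℝ 0ℝ ]
  log (fromℕ p) 0<p ÷ℝ log (log (fromℕ p) 0<p) 0<logp [ loglogp#0 ]
  ≤ℝ fromℚ ((+ 57 / 10) *ℚ ι n)
log/loglog-≤ {p} {n} 0<n 8^97≤p p<10^10n =
  0<p , 0<logp , inj₂ 0<loglogp
  , ÷-≤ {log (fromℕ p) 0<p} {log (log (fromℕ p) 0<p) 0<logp} 0<loglogp
      (0≤* (ℚ.<⇒≤ (ℚ.positive⁻¹ (+ 57 / 10))) (0≤ι n)) Lloglogp
      (log-U 0<p (10 * n) (*-mono-< {0} {10} (s≤s z≤n) 0<n) p<10^10n (25n<5·7n·4·39 n 0<n))
  where
  -- `log-L` asks for a strict inequality, so 8^97 = 2^291 is lowered to 2^290; 290/2 = 145 still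
  -- exceeds 144.
  2^290<p : 2 ^ 290 < p
  2^290<p = <-≤-trans (<ᵇ⇒< (2 ^ 290) (8 ^ 97) _) 8^97≤p
  0<p : 0ℝ <ℝ fromℕ p
  0<p = ι 1 , 0<ι 0 , ι-mono-< (<-trans (<ᵇ⇒< 1 (2 ^ 290) _) 2^290<p)
  Llogp : L (log (fromℕ p) 0<p) (ι 144)
  Llogp = log-L 0<p 290 (s≤s z≤n) 2^290<p (toWitness {a? = ι 144 ℚ.<? ι 290 *ℚ ½} _)
  0<logp : 0ℝ <ℝ log (fromℕ p) 0<p
  0<logp = ι 144 , 0<ι 143 , Llogp
  -- Lower cuts are open, so 22/5 is lowered to 4.39; 5.7 * 4.39 = 25.023 still exceeds 25.
  Lloglogp : L (log (log (fromℕ p) 0<p) 0<logp) (+ 439 / 100)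
  Lloglogp = log-144-L (log (fromℕ p) 0<p) 0<logp Llogp (toWitness {a? = + 439 / 100 ℚ.<? + 22 / 5} _)
  0<loglogp : 0ℝ <ℝ log (log (fromℕ p) 0<p) 0<logp
  0<loglogp = + 439 / 100 , ℚ.positive⁻¹ (+ 439 / 100) , Lloglogp

theorem1 : (l : ℕ) → 1 ≤ l → (S : Vec Decimal l) →
    ∃[ p ] Prime p × p Contains S ×
    Σ[ 0<p ∈ 0ℝ <ℝ fromℕ p ]
    Σ[ 0<logp ∈ 0ℝ <ℝ log (fromℕ p) 0<p ]
    Σ[ loglogp#0 ∈ log (log (fromℕ p) 0<p) 0<logp #ℝ 0ℝ ]
    log (fromℕ p) 0<p ÷ℝ log (log (fromℕ p) 0<p) 0<logp [ loglogp#0 ]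
    ≤ℝ fromℚ ((+ 57 / 10) *ℚ (+ (l ^ 2 * 10 ^ l) / 1))
theorem1 l 1≤l S =
  let p , isPrime , p∋S , 8^97≤p , p<10^10n = ∃-prime-containing 1≤l S
  in  p , isPrime , p∋S , log/loglog-≤ (*-mono-< (m^n>0 l {{>-nonZero 1≤l}} 2) (m^n>0 10 l)) 8^97≤p p<10^10n
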